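{- Let $(\varepsilon_n)$ be a sequence of reals with $\varepsilon_n \to 0$. There exists $N$ such that the following holds for every odd $n \ge N$. Let $G$ be a $d$-regular graph on $V = [n]$ with $\lfloor 0.293 n \rfloor - 1 \le d \le (n-3)/2$, $|\mathrm{aut}(B_1(G))| = 1$, and $|B_1(u) \cap B_1(v)| = (1 + o(1)) d^2/n$ for every pair of vertices $u \ne v$, meaning $\bigl|\,|B_1(u)\cap B_1(v)| - d^2/n\,\bigr| \le \varepsilon_n d^2/n$. Then the graphic voting rule $\Phi_G$ is an odd, monotone, unbiased voting rule with $|\mathrm{aut}(\Phi_G)| = 1$. Moreover, $\Phi_G$ has winning coalitions of size $d+1$.
   Context: A voting rule on $n$ voters is a function $\Phi : \{ -1,1\}^n \to \{ -1,1\}$. It is odd if $\Phi(-x) = -\Phi(x)$ for all $x$, and monotone if $\Phi(x) \ge \Phi(x')$ whenever $x \ge x'$ coordinate-wise. A permutation $\sigma$ of $[n]$ acts on $\{ -1,1\}^n$ by permuting coordinates, and on voting rules by $(\sigma\Phi)(x) = \Phi(\sigma^{ -1}(x))$; $\mathrm{aut}(\Phi)$ is the group of permutations $\sigma$ with $\sigma\Phi = \Phi$. For $x \in \{ -1,1\}^n$ let $x^{\oplus i}$ be $x$ with its $i$-th coordinate negated. For a probability measure $q$ on $\{ -1,1\}^n$, $\mathbb{I}_i^q(\Phi) = \mathbb{P}_{x \sim q}[\Phi(x) \ne \Phi(x^{\oplus i})]$. $\Phi$ is unbiased if $\mathbb{I}_1^q(\Phi) = \cdots = \mathbb{I}_n^q(\Phi)$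 for every i.i.d. measure $q = p^{\otimes n}$, $p$ a probability measure on $\{ -1,1\}$. A winning coalition for $\Phi$ is a set $S \subseteq [n]$ such that for each $y \in \{ -1,1\}$, whenever $x_i = y$ for all $i \in S$, then $\Phi(x) = y$. For a (simple, undirected) graph $G$ on $V = [n]$ with graph distance $d(\cdot,\cdot)$, $B_r(v) = \{u \in V : d(u,v) \le r\}$ and $B_r(G) = \{B_r(v) : v \in V\}$. The radius is (non-standardly) defined as $\mathrm{rad}(G) = \lceil \mathrm{diam}(G)/2 \rceil$, so that any two balls of radius $\mathrm{rad}(G)$ intersect. For a permutation $\sigma$ of $V$, $\sigma(G)$ is the graph with edges $\{\sigma(u),\sigma(v)\}$ for edges $\{u,v\}$ of $G$, and $\mathrm{aut}(B_1(G))$ is the set of permutations $\sigma$ with $B_1(\sigma(G)) = B_1(G)$ (equality of sets of subsets of $V$). For $n$ odd and $r = \mathrm{rad}(G)$, the graphic voting rule $\Phi_G$ is defined by: $\Phi_G(x) = y$ if there exist $v \in V$ and $y \in \{ -1,1\}$ with $x_i = y$ for all $i \in B_r(v)$, and $\Phi_G(x) = \mathrm{maj}_n(x)$ (the majority value among the coordinates of $x$) otherwise. -}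

module Defs where

open import Data.Bool.Base using (if_then_else_)
open import Data.Fin.Base using (Fin)
open import Data.Fin.Permutation using (Permutation′; _⟨$⟩ˡ_; flip)
open import Data.Fin.Properties using (any?; all?) renaming (_≟_ to _≟ᶠ_)
open import Data.Fin.Subset using (Subset; _∈_; ∣_∣)
open import Data.Fin.Subset.Properties using (_∈?_)
import Data.Integer.Base as ℤ
open import Data.List.Base using (allFin; cartesianProductWith; filter; head; upTo)
import Data.List.Extrema as Extrema
import Data.Maybe.Base as Maybe
open import Data.Nat.Base as ℕ using (ℕ; zero; suc; ⌈_/2⌉)
import Data.Nat.Properties as ℕ
open import Data.Product.Base using (∃-syntax; _×_; _,_)
open import Data.Rational.Base as ℚ using (ℚ; 0ℚ; 1ℚ; ½)
import Data.Rational.Properties as ℚ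
open import Data.Rational.Solver using (module +-*-Solver)
open import Data.Sign.Base using (Sign; +; -; opposite)
open import Data.Sign.Properties using () renaming (_≟_ to _≟ˢ_)
open import Data.Vec.Base using (Vec; []; _∷_; count; lookup; map; tabulate; _[_]%=_)
open import Level using (0ℓ)
open import Relation.Binary.Bundles using (TotalOrder)
open import Relation.Binary.Core using (Rel)
import Relation.Binary.Construct.Add.Supremum.NonStrict ℕ._≤_ as ⁺
import Relation.Binary.Definitions as B
open import Relation.Binary.PropositionalEquality
  using (_≡_; refl; sym; trans; cong; subst; subst₂)
open import Relation.Nullary.Construct.Add.Supremum using (_⁺; [_])
open import Relation.Nullary.Decidable using (does; ¬?; map′; _×-dec_; _→-dec_)
open import Relation.Unary using (Pred; Decidable; _≐_)

private
  variable
    n : ℕ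

record ℝ : Set where
  constructor mkℝ
  field
    approx : ℕ → ℚ
    cauchy : ∀ δ → 0ℚ ℚ.< δ → ∃[ N ] ∀ k l → N ℕ.≤ k → N ℕ.≤ l →
             ℚ.∣ approx k ℚ.- approx l ∣ ℚ.≤ δ

open ℝ public

infix 4 _≤ᴿ_ _≃ᴿ_
infixl 6 _+ᴿ_
infixl 7 _*ᴿ_

_≤ᴿ_ : Rel ℝ 0ℓ
x ≤ᴿ y = ∀ δ → 0ℚ ℚ.< δ → ∃[ N ] ∀ k → N ℕ.≤ k → approx x k ℚ.≤ approx y k ℚ.+ δ

-- Cauchy sequences are not quotiented, so this is the equality of reals.
_≃ᴿ_ : Rel ℝ 0ℓ
x ≃ᴿ y = ∀ δ → 0ℚ ℚ.< δ → ∃[ N ] ∀ k → N ℕ.≤ k →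
         ℚ.∣ approx x k ℚ.- approx y k ∣ ℚ.≤ δ

fromℚ : ℚ → ℝ
fromℚ q .approx _ = q
fromℚ q .cauchy δ 0<δ = 0 , λ _ _ _ _ →
  subst (λ r → ℚ.∣ r ∣ ℚ.≤ δ) (sym (ℚ.+-inverseʳ q)) (ℚ.<⇒≤ 0<δ)

0ᴿ 1ᴿ : ℝ
0ᴿ = fromℚ 0ℚ
1ᴿ = fromℚ 1ℚ

private
  open +-*-Solver

  pos-* : ∀ {p q} → 0ℚ ℚ.< p → 0ℚ ℚ.< q → 0ℚ ℚ.< p ℚ.* q
  pos-* {p} {q} 0<p 0<q =
    ℚ.positive⁻¹ (p ℚ.* q) {{ℚ.pos*pos⇒pos p {{ℚ.positive 0<p}} q {{ℚ.positive 0<q}}}}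

  halves : ∀ δ → δ ℚ.* ½ ℚ.+ δ ℚ.* ½ ≡ δ
  halves δ = trans (sym (ℚ.*-distribˡ-+ δ ½ ½)) (ℚ.*-identityʳ δ)

  +-diff : ∀ a b c d → (a ℚ.+ b) ℚ.- (c ℚ.+ d) ≡ (a ℚ.- c) ℚ.+ (b ℚ.- d)
  +-diff = solve 4 (λ a b c d → (a :+ b) :- (c :+ d) := (a :- c) :+ (b :- d)) refl

  *-diff : ∀ a b c d → a ℚ.* b ℚ.- c ℚ.* d ≡ a ℚ.* (b ℚ.- d) ℚ.+ d ℚ.* (a ℚ.- c)
  *-diff = solve 4 (λ a b c d → a :* b :- c :* d := a :* (b :- d) :+ d :* (a :- c)) refl

  split-diff : ∀ a b → a ≡ b ℚ.+ (a ℚ.- b)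
  split-diff = solve 2 (λ a b → a := b :+ (a :- b)) refl

  *-mono : ∀ {a b c d} → 0ℚ ℚ.≤ b → 0ℚ ℚ.≤ c → a ℚ.≤ b → c ℚ.≤ d → a ℚ.* c ℚ.≤ b ℚ.* d
  *-mono {a} {b} {c} {d} 0≤b 0≤c a≤b c≤d = ℚ.≤-trans
    (ℚ.*-monoʳ-≤-nonNeg c {{ℚ.nonNegative 0≤c}} a≤b)
    (ℚ.*-monoˡ-≤-nonNeg b {{ℚ.nonNegative 0≤b}} c≤d)

  bounded : ∀ x → ∃[ K ] 0ℚ ℚ.< K × (∃[ N ] ∀ k → N ℕ.≤ k → ℚ.∣ approx x k ∣ ℚ.≤ K)
  bounded x with cauchy x 1ℚ (ℚ.positive⁻¹ 1ℚ)
  ... | N , c = ℚ.∣ a ∣ ℚ.+ 1ℚ , 0<K , N , λ k N≤k → ℚ.≤-trans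
          (subst (λ r → ℚ.∣ r ∣ ℚ.≤ ℚ.∣ a ∣ ℚ.+ ℚ.∣ approx x k ℚ.- a ∣)
            (sym (split-diff (approx x k) a))
            (ℚ.∣p+q∣≤∣p∣+∣q∣ a (approx x k ℚ.- a)))
          (ℚ.+-monoʳ-≤ ℚ.∣ a ∣ (c k N N≤k ℕ.≤-refl))
    where
    a   = approx x N
    0<K : 0ℚ ℚ.< ℚ.∣ a ∣ ℚ.+ 1ℚ
    0<K = ℚ.+-mono-≤-< (ℚ.0≤∣p∣ a) (ℚ.positive⁻¹ 1ℚ)

  *-bound : ∀ a b {M η} → 0ℚ ℚ.≤ M → ℚ.∣ a ∣ ℚ.≤ M → ℚ.∣ b ∣ ℚ.≤ η →
            ℚ.∣ a ℚ.* b ∣ ℚ.≤ M ℚ.* η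
  *-bound a b {M} {η} 0≤M a≤ b≤ =
    subst (ℚ._≤ M ℚ.* η) (sym (ℚ.∣p*q∣≡∣p∣*∣q∣ a b)) (*-mono 0≤M (ℚ.0≤∣p∣ b) a≤ b≤)

  *-close : ∀ a b c d {K L η} → 0ℚ ℚ.≤ K → 0ℚ ℚ.≤ L →
            ℚ.∣ a ∣ ℚ.≤ K → ℚ.∣ d ∣ ℚ.≤ L →
            ℚ.∣ a ℚ.- c ∣ ℚ.≤ η → ℚ.∣ b ℚ.- d ∣ ℚ.≤ η →
            ℚ.∣ a ℚ.* b ℚ.- c ℚ.* d ∣ ℚ.≤ (K ℚ.+ L) ℚ.* η
  *-close a b c d {K} {L} {η} 0≤K 0≤L a≤ d≤ ac bd = subst₂ ℚ._≤_
    (cong ℚ.∣_∣ (sym (*-diff a b c d)))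
    (sym (ℚ.*-distribʳ-+ η K L))
    (ℚ.≤-trans (ℚ.∣p+q∣≤∣p∣+∣q∣ (a ℚ.* (b ℚ.- d)) (d ℚ.* (a ℚ.- c)))
      (ℚ.+-mono-≤ (*-bound a (b ℚ.- d) 0≤K a≤ bd) (*-bound d (a ℚ.- c) 0≤L d≤ ac)))

  divide : ∀ K δ → 0ℚ ℚ.< K → 0ℚ ℚ.< δ → ∃[ η ] 0ℚ ℚ.< η × K ℚ.* η ≡ δ
  divide K δ 0<K 0<δ = K⁻¹ ℚ.* δ , pos-* (ℚ.positive⁻¹ K⁻¹ {{ℚ.1/pos⇒pos K}}) 0<δ ,
    trans (sym (ℚ.*-assoc K K⁻¹ δ)) (trans (cong (ℚ._* δ) (ℚ.*-inverseʳ K)) (ℚ.*-identityˡ δ))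
    where
    instance
      K>0 : ℚ.Positive K
      K>0 = ℚ.positive 0<K
      K≢0 : ℚ.NonZero K
      K≢0 = ℚ.pos⇒nonZero K
    K⁻¹ = ℚ.1/ K

_+ᴿ_ : ℝ → ℝ → ℝ
(x +ᴿ y) .approx k = approx x k ℚ.+ approx y k
(x +ᴿ y) .cauchy δ 0<δ
  with cauchy x (δ ℚ.* ½) (pos-* 0<δ (ℚ.positive⁻¹ ½))
     | cauchy y (δ ℚ.* ½) (pos-* 0<δ (ℚ.positive⁻¹ ½))
... | M , cx | N , cy = M ℕ.⊔ N , λ k l k≥ l≥ → subst₂ ℚ._≤_
        (cong ℚ.∣_∣ (sym (+-diff (approx x k) (approx y k) (approx x l) (approx y l))))
        (halves δ)
        (ℚ.≤-trans
          (ℚ.∣p+q∣≤∣p∣+∣q∣ (approx x k ℚ.- approx x l) (approx y k ℚ.- approx y l))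
          (ℚ.+-mono-≤ (cx k l (ℕ.m⊔n≤o⇒m≤o M N k≥) (ℕ.m⊔n≤o⇒m≤o M N l≥))
                      (cy k l (ℕ.m⊔n≤o⇒n≤o M N k≥) (ℕ.m⊔n≤o⇒n≤o M N l≥))))

_*ᴿ_ : ℝ → ℝ → ℝ
(x *ᴿ y) .approx k = approx x k ℚ.* approx y k
(x *ᴿ y) .cauchy δ 0<δ =
  let K , 0<K , A , bx = bounded x
      L , 0<L , B , by = bounded y
      η , 0<η , total  = divide (K ℚ.+ L) δ (ℚ.+-mono-< 0<K 0<L) 0<δ
      C , cx           = cauchy x η 0<η
      D , cy           = cauchy y η 0<η
  in (A ℕ.⊔ B) ℕ.⊔ (C ℕ.⊔ D) , λ k l k≥ l≥ →
  let k≥AB = ℕ.m⊔n≤o⇒m≤o (A ℕ.⊔ B) (C ℕ.⊔ D) k≥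
      l≥AB = ℕ.m⊔n≤o⇒m≤o (A ℕ.⊔ B) (C ℕ.⊔ D) l≥
      k≥CD = ℕ.m⊔n≤o⇒n≤o (A ℕ.⊔ B) (C ℕ.⊔ D) k≥
      l≥CD = ℕ.m⊔n≤o⇒n≤o (A ℕ.⊔ B) (C ℕ.⊔ D) l≥
  in ℚ.≤-trans
       (*-close (approx x k) (approx y k) (approx x l) (approx y l)
         (ℚ.<⇒≤ 0<K) (ℚ.<⇒≤ 0<L)
         (bx k (ℕ.m⊔n≤o⇒m≤o A B k≥AB)) (by l (ℕ.m⊔n≤o⇒n≤o A B l≥AB))
         (cx k l (ℕ.m⊔n≤o⇒m≤o C D k≥CD) (ℕ.m⊔n≤o⇒m≤o C D l≥CD))
         (cy k l (ℕ.m⊔n≤o⇒n≤o C D k≥CD) (ℕ.m⊔n≤o⇒n≤o C D l≥CD)))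
       (ℚ.≤-reflexive total)

-- By the Archimedean property rational tolerances δ suffice.
infix 4 _⟶0

_⟶0 : (ℕ → ℝ) → Set
ε ⟶0 = ∀ δ → 0ℚ ℚ.< δ → ∃[ N ] ∀ k → N ℕ.≤ k →
       fromℚ (ℚ.- δ) ≤ᴿ ε k × ε k ≤ᴿ fromℚ δ

-- The cube {-1,1}ⁿ is Vec Sign n.
VotingRule : ℕ → Set
VotingRule n = Vec Sign n → Sign

infix 4 _≤ˢ_

_≤ˢ_ : Rel Sign 0ℓ
s ≤ˢ t = (s ℤ.◃ 1) ℤ.≤ (t ℤ.◃ 1)

IsOdd : VotingRule n → Set
IsOdd Φ = ∀ x → Φ (map opposite x) ≡ opposite (Φ x)

IsMonotone : VotingRule n → Set
IsMonotone Φ = ∀ x x′ → (∀ i → lookup x′ i ≤ˢ lookup x i) → Φ x′ ≤ˢ Φ x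

permute : Permutation′ n → Vec Sign n → Vec Sign n
permute σ x = tabulate λ i → lookup x (σ ⟨$⟩ˡ i)

permuteRule : Permutation′ n → VotingRule n → VotingRule n
permuteRule σ Φ x = Φ (permute (flip σ) x)

Aut : VotingRule n → Pred (Permutation′ n) 0ℓ
Aut Φ σ = ∀ x → permuteRule σ Φ x ≡ Φ x

_⊕_ : Vec Sign n → Fin n → Vec Sign n
x ⊕ i = x [ i ]%= opposite

sumCube : (Vec Sign n → ℝ) → ℝ
sumCube {zero}  f = f []
sumCube {suc n} f = sumCube (λ x → f (- ∷ x)) +ᴿ sumCube (λ x → f (+ ∷ x))

-- The probability of an event under the measure with point masses q.
ℙ : (Vec Sign n → ℝ) → {E : Pred (Vec Sign n) 0ℓ} → Decidable E → ℝ
ℙ q E? = sumCube λ x → if does (E? x) then q x else 0ᴿ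

influence : (Vec Sign n → ℝ) → Fin n → VotingRule n → ℝ
influence q i Φ = ℙ q λ x → ¬? (Φ x ≟ˢ Φ (x ⊕ i))

record ProbSign : Set where
  field
    mass   : Sign → ℝ
    nonNeg : ∀ s → 0ᴿ ≤ᴿ mass s
    total  : mass - +ᴿ mass + ≃ᴿ 1ᴿ

open ProbSign public

-- p ^⊗ is the product measure p^{⊗n}, given by its point masses.
_^⊗ : ProbSign → Vec Sign n → ℝ
(p ^⊗) []      = 1ᴿ
(p ^⊗) (s ∷ x) = mass p s *ᴿ (p ^⊗) x

IsUnbiased : VotingRule n → Set
IsUnbiased Φ = ∀ p i j → influence (p ^⊗) i Φ ≃ᴿ influence (p ^⊗) j Φ

Unanimous : Sign → Vec Sign n → Pred (Subset n) 0ℓ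
Unanimous y x S = ∀ i → i ∈ S → lookup x i ≡ y

IsWinningCoalition : VotingRule n → Pred (Subset n) 0ℓ
IsWinningCoalition Φ S = ∀ y x → Unanimous y x S → Φ x ≡ y

-- For odd n there are no ties.
maj : VotingRule n
maj x = if does (count (- ≟ˢ_) x ℕ.<? count (+ ≟ˢ_) x) then + else -

record Graph (n : ℕ) : Set₁ where
  field
    Adj     : Rel (Fin n) 0ℓ
    adj?    : B.Decidable Adj
    symm    : B.Symmetric Adj
    irrefl  : B.Irreflexive _≡_ Adj

open Graph public

subset : {P : Pred (Fin n) 0ℓ} → Decidable P → Subset n
subset P? = tabulate λ u → does (P? u)

IsRegular : Graph n → ℕ → Set
IsRegular G d = ∀ v → ∣ subset (adj? G v) ∣ ≡ d

data Walk (G : Graph n) : ℕ → Rel (Fin n) 0ℓ where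
  []  : ∀ {v} → Walk G 0 v v
  _∷_ : ∀ {k u v w} → Adj G u v → Walk G k v w → Walk G (suc k) u w

walk? : (G : Graph n) → ∀ k → B.Decidable (Walk G k)
walk? G zero u v = map′ (λ { refl → [] }) (λ { [] → refl }) (u ≟ᶠ v)
walk? G (suc k) u w = map′ (λ (_ , e , p) → e ∷ p) (λ { (e ∷ p) → _ , e , p })
  (any? λ v → adj? G u v ×-dec walk? G k v w)

-- ⊤⁺ represents ∞, the distance between different components.
ℕ∞ : Set
ℕ∞ = ℕ ⁺

infix 4 _≤∞_ _≤∞?_

_≤∞_ : Rel ℕ∞ 0ℓ
_≤∞_ = ⁺._≤⁺_

_≤∞?_ : B.Decidable _≤∞_
_≤∞?_ = ⁺.≤⁺-dec ℕ._≤?_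

≤∞-totalOrder : TotalOrder 0ℓ 0ℓ 0ℓ
≤∞-totalOrder = record { isTotalOrder = ⁺.≤⁺-isTotalOrder-≡ ℕ.≤-isTotalOrder }

-- A shortest walk on n vertices has length less than n.
dist : Graph n → Fin n → Fin n → ℕ∞
dist {n} G u v = head (filter (λ k → walk? G k u v) (upTo n))

diam : Graph n → ℕ∞
diam {n} G = Extrema.max ≤∞-totalOrder [ 0 ]
  (cartesianProductWith (dist G) (allFin n) (allFin n))

-- rad G = ⌈diam G / 2⌉, not the usual graph radius.
rad : Graph n → ℕ∞
rad G = Maybe.map ⌈_/2⌉ (diam G)

ball : Graph n → ℕ∞ → Fin n → Subset n
ball G r v = subset λ u → dist G v u ≤∞? r

balls : Graph n → ℕ∞ → Pred (Subset n) 0ℓ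
balls G r S = ∃[ v ] S ≡ ball G r v

B₁ : Graph n → Fin n → Subset n
B₁ G = ball G [ 1 ]

-- Vertices u and v of permuteGraph σ G are adjacent when u = σ a and
-- v = σ b for adjacent vertices a and b of G.
permuteGraph : Permutation′ n → Graph n → Graph n
permuteGraph σ G = record
  { Adj    = λ u v → Adj G (σ ⟨$⟩ˡ u) (σ ⟨$⟩ˡ v)
  ; adj?   = λ u v → adj? G (σ ⟨$⟩ˡ u) (σ ⟨$⟩ˡ v)
  ; symm   = symm G
  ; irrefl = λ { refl → irrefl G refl }
  }

AutB₁ : Graph n → Pred (Permutation′ n) 0ℓ
AutB₁ G σ = balls (permuteGraph σ G) [ 1 ] ≐ balls G [ 1 ]

HasUnanimousBall : Graph n → Sign → Pred (Vec Sign n) 0ℓ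
HasUnanimousBall G y x = ∃[ v ] Unanimous y x (ball G (rad G) v)

hasUnanimousBall? : (G : Graph n) (y : Sign) → Decidable (HasUnanimousBall G y)
hasUnanimousBall? G y x = any? λ v → all? λ i →
  (i ∈? ball G (rad G) v) →-dec (lookup x i ≟ˢ y)

-- The order of the two tests is immaterial: any two balls of radius
-- rad G intersect, so at most one of them succeeds.
graphicRule : Graph n → VotingRule n
graphicRule G x =
  if does (hasUnanimousBall? G + x) then + else
  if does (hasUnanimousBall? G - x) then - else
  maj x

{-# OPTIONS --safe #-}
module Submission where

-- Any two balls of radius 1 meet, so rad G = 1 and the balls in question have d + 1 elements.
-- Since 2α − α² > 1/2 for α ≥ 0.293, the union of two distinct balls has more than n/2
-- elements, while a single ball has fewer.  Hence among vectors x with k < n/2 pluses, Φ x = +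
-- exactly when the pluses of x cover a ball, and that ball is unique.  The number of such x with
-- x_i = + is a sum over balls B of a binomial coefficient depending only on |B ∪ {i}|; as i lies
-- in exactly d + 1 balls, it does not depend on i.  Negation transfers this to k > n/2, so the
-- number of vectors at each level for which i is pivotal is independent of i, and the influences
-- agree for every product measure.  Moreover the vectors with d + 1 pluses and Φ x = + are
-- precisely the balls, so an automorphism of Φ permutes the balls and is trivial.

open import Defs
import Data.Nat.Properties as ℕ
import Data.Rational.Base as ℚ
import Data.Rational.Properties as ℚ
open import Relation.Binary.PropositionalEquality

-- The passage from counts to influences rests on one family of numbers: how many `x` of a given
-- level have `x_i = +` and `Φ x = +`. The number of all `x` with `Φ x = +` does not mention i, so
-- the count with `x_i = -` is independent of i as well, and monotonicity expresses pivotality as a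
-- signed combination of these counts at neighbouring levels. Levels are handled by an arbitrary
-- weight `h : ℕ → ℚ` on the number of pluses, which also absorbs the product measure. The obstacle
-- is that above n/2 several balls can be covered at once and the majority vote interferes; hence
-- the split of `h` at n/2 and the reflection. The constant 0.293 lies barely above 1 - 1/√2 ≈
-- 0.29289, a root of 2α - α² = 1/2. At α = 0.293 the margin is only about 0.00015, so all error
-- terms are tracked explicitly; the tolerance 1/100000 and the threshold 10000 are chosen to fit
-- into it.

-- Inequalities over ℕ for unions and intersections of two balls

module NaturalEstimates where

  open import Data.Nat.Base hiding (_/_; _%_)
  open import Data.Nat.DivMod using (_/_; _%_; m≡m%n+[m/n]*n; m%n<n)
  open import Data.Nat.Properties
  open import Data.Nat.Solver using (module +-*-Solver)

  -- This is (q - p)(s - r) ≥ 0 multiplied out without subtraction, the form in which a product of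
  -- two slacks can enter a certificate over ℕ.
  rearrangement : ∀ {p q r s} → p ≤ q → r ≤ s → q * r + p * s ≤ q * s + p * r
  rearrangement {p} {q} {r} {s} p≤q r≤s = subst₂ (λ q s → q * r + p * s ≤ q * s + p * r)
    (m+[n∸m]≡n p≤q) (m+[n∸m]≡n r≤s)
    (subst ((p + (q ∸ p)) * r + p * (r + (s ∸ r)) ≤_) (identity p (q ∸ p) r (s ∸ r))
      (m≤m+n _ ((q ∸ p) * (s ∸ r))))
    where
    open +-*-Solver
    identity : ∀ p f r h → (p + f) * r + p * (r + h) + f * h ≡ (p + f) * (r + h) + p * r
    identity = solve 4 (λ p f r h → (p :+ f) :* r :+ p :* (r :+ h) :+ f :* h := (p :+ f) :* (r :+ h) :+ p :* r) refl

  -- With F = k d + w − u n, H = n − 2 d and T = n − N, all nonnegative, k times the difference of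
  -- the two sides is α F H + β F n + γ T n + x d n + y d + z n; the equations match coefficients.
  union-certificate : ∀ {k D u w N α β γ x y z} .{{_ : NonZero k}} →
    k * D + γ ≡ α * u + β * u →
    α * k + 2 * (u * α) + β * k + x ≡ 4 * (k * D) →
    2 * (k * D) + 4 * k ≡ 2 * (α * k) →
    y ≡ 2 * (α * w) →
    2 * k + α * w + β * w + z ≡ 4 * (k * D) + γ * N →
    ∀ d n → u * n ≤ k * d + w → 2 * d ≤ n → N ≤ n →
    n * n * D + 2 * (d * d * D + (d * d + d * d + n)) ≤ 4 * (d + 1) * (n * D)
  union-certificate {k} {D} {u} {w} {N} {α} {β} {γ} {x} {y} {z} nn dn dd d1 n1 d n low high big =
    *-cancelˡ-≤ k (+-cancelʳ-≤ upper _ _ (begin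
      k * L + upper           ≤⟨ m≤m+n (k * L + upper) extra ⟩
      k * L + upper + extra   ≡⟨ expandˡ ⟩
      quadratic (k * D + γ) (α * k + 2 * (u * α) + β * k + x) (2 * (k * D) + 4 * k) y (2 * k + α * w + β * w + z)
        ≡⟨ quadratic-cong nn dn dd d1 n1 ⟩
      quadratic (α * u + β * u) (4 * (k * D)) (2 * (α * k)) (2 * (α * w)) (4 * (k * D) + γ * N)
        ≡⟨ expandʳ ⟨
      k * R + lower           ≤⟨ +-monoʳ-≤ (k * R) (+-mono-≤ (+-mono-≤
          (*-monoʳ-≤ α (rearrangement low high))
          (*-monoʳ-≤ β (*-monoˡ-≤ n low)))
          (*-monoʳ-≤ γ (*-monoˡ-≤ n big))) ⟩
      k * R + upper           ∎))
    where
    open ≤-Reasoning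
    open +-*-Solver
    L R lower upper extra : ℕ
    L = n * n * D + 2 * (d * d * D + (d * d + d * d + n))
    R = 4 * (d + 1) * (n * D)
    lower = α * ((k * d + w) * (2 * d) + u * n * n) + β * (u * n * n) + γ * (N * n)
    upper = α * ((k * d + w) * n + u * n * (2 * d)) + β * ((k * d + w) * n) + γ * (n * n)
    extra = x * (d * n) + y * d + z * n

    quadratic : ℕ → ℕ → ℕ → ℕ → ℕ → ℕ
    quadratic a b c e f = a * (n * n) + b * (d * n) + c * (d * d) + e * d + f * n

    quadratic-cong : ∀ {a a′ b b′ c c′ e e′ f f′} → a ≡ a′ → b ≡ b′ → c ≡ c′ → e ≡ e′ → f ≡ f′ →
      quadratic a b c e f ≡ quadratic a′ b′ c′ e′ f′
    quadratic-cong refl refl refl refl refl = refl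

    expandˡ : k * L + upper + extra ≡
      quadratic (k * D + γ) (α * k + 2 * (u * α) + β * k + x) (2 * (k * D) + 4 * k) y (2 * k + α * w + β * w + z)
    expandˡ = solve 12 (λ k D u w α β γ x y z d n →
      k :* (n :* n :* D :+ con 2 :* (d :* d :* D :+ (d :* d :+ d :* d :+ n))) :+
        (α :* ((k :* d :+ w) :* n :+ u :* n :* (con 2 :* d)) :+ β :* ((k :* d :+ w) :* n) :+ γ :* (n :* n)) :+
        (x :* (d :* n) :+ y :* d :+ z :* n) :=
      (k :* D :+ γ) :* (n :* n) :+ (α :* k :+ con 2 :* (u :* α) :+ β :* k :+ x) :* (d :* n) :+
        (con 2 :* (k :* D) :+ con 4 :* k) :* (d :* d) :+ y :* d :+ (con 2 :* k :+ α :* w :+ β :* w :+ z) :* n)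
      refl k D u w α β γ x y z d n

    expandʳ : k * R + lower ≡
      quadratic (α * u + β * u) (4 * (k * D)) (2 * (α * k)) (2 * (α * w)) (4 * (k * D) + γ * N)
    expandʳ = solve 10 (λ k D u w N α β γ d n →
      k :* (con 4 :* (d :+ con 1) :* (n :* D)) :+
        (α :* ((k :* d :+ w) :* (con 2 :* d) :+ u :* n :* n) :+ β :* (u :* n :* n) :+ γ :* (N :* n)) :=
      (α :* u :+ β :* u) :* (n :* n) :+ con 4 :* (k :* D) :* (d :* n) :+ con 2 :* (α :* k) :* (d :* d) :+
        con 2 :* (α :* w) :* d :+ (con 4 :* (k :* D) :+ γ :* N) :* n)
      refl k D u w N α β γ d n

  -- The coefficient of d² forces α = D + 2, and β is the largest integer that the coefficient of d
  -- n allows. What then remains at n² is γ, positive because 0.293 > 1 - 1/√2; for n ≥ 10000 it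
  -- also pays for the terms linear in n that rounding causes.
  union-estimate : ∀ d n → 293 * n ≤ 1000 * d + 2000 → 2 * d ≤ n → 10000 ≤ n →
    n * n * 100000 + 2 * (d * d * 100000 + (d * d + d * d + n)) ≤ 4 * (d + 1) * (n * 100000)
  union-estimate = union-certificate
    {1000} {100000} {293} {2000} {10000} {100002} {241396} {29614} {828} {400008000} {13342000}
    refl refl refl refl refl

  -- Since m = 2 (d + 1) - c, an upper bound on the intersection is a lower bound on the union. The
  -- hypothesis `estimate` is n + 2 c ≤ 4 (d + 1), multiplied by n D and with c replaced by its
  -- upper bound.
  union-large : ∀ n c m d D .{{_ : NonZero n}} .{{_ : NonZero D}} →
    n * n * D + 2 * (d * d * D + (d * d + d * d + n)) ≤ 4 * (d + 1) * (n * D) →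
    c * n * D ≤ d * d * D + (d * d + d * d + n) → m + c ≡ suc d + suc d → n ≤ m + m
  union-large n c m d D estimate upper m+c = +-cancelʳ-≤ (2 * c) n (m + m) (begin
    n + 2 * c             ≤⟨ *-cancelʳ-≤ (n + 2 * c) (4 * (d + 1)) (n * D) {{m*n≢0 n D}} (begin
      (n + 2 * c) * (n * D)                                ≡⟨ expand n c D ⟩
      n * n * D + 2 * (c * n * D)                          ≤⟨ +-monoʳ-≤ (n * n * D) (*-monoʳ-≤ 2 upper) ⟩
      n * n * D + 2 * (d * d * D + (d * d + d * d + n))    ≤⟨ estimate ⟩
      4 * (d + 1) * (n * D)                                ∎) ⟩
    4 * (d + 1)           ≡⟨ double d ⟩
    2 * (suc d + suc d)   ≡⟨ cong (2 *_) m+c ⟨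
    2 * (m + c)           ≡⟨ distribute m c ⟩
    m + m + 2 * c         ∎)
    where
    open ≤-Reasoning
    open +-*-Solver
    expand : ∀ n c D → (n + 2 * c) * (n * D) ≡ n * n * D + 2 * (c * n * D)
    expand = solve 3 (λ n c D → (n :+ con 2 :* c) :* (n :* D) := n :* n :* D :+ con 2 :* (c :* n :* D)) refl
    double : ∀ d → 4 * (d + 1) ≡ 2 * (suc d + suc d)
    double = solve 1 (λ d → con 4 :* (d :+ con 1) := con 2 :* ((con 1 :+ d) :+ (con 1 :+ d))) refl
    distribute : ∀ m c → 2 * (m + c) ≡ m + m + 2 * c
    distribute = solve 2 (λ m c → con 2 :* (m :+ c) := m :+ m :+ con 2 :* c) refl

  n≤4d : ∀ d n → 293 * n ≤ 1000 * d + 2000 → 10000 ≤ n → n ≤ 4 * d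
  n≤4d d n low big = *-cancelˡ-≤ 250 (+-cancelʳ-≤ 2000 (250 * n) (250 * (4 * d)) (begin
    250 * n + 2000      ≤⟨ +-monoʳ-≤ (250 * n) (≤-trans (≤ᵇ⇒≤ 2000 (43 * 10000) _) (*-monoʳ-≤ 43 big)) ⟩
    250 * n + 43 * n    ≡⟨ *-distribʳ-+ n 250 43 ⟨
    293 * n             ≤⟨ low ⟩
    1000 * d + 2000     ≡⟨ cong (_+ 2000) (*-assoc 250 4 d) ⟩
    250 * (4 * d) + 2000 ∎))
    where open ≤-Reasoning

  -- If c were 0, then d² D ≤ 2 d² + n, and n ≤ 4 d ≤ 4 d² would leave D ≤ 6.
  intersection-nonzero : ∀ c n d D → 0 < n → 6 < D → n ≤ 4 * d →
    d * d * D ≤ c * n * D + (d * d + d * d + n) → c ≢ 0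
  intersection-nonzero _ n zero D 0<n _ n≤4d _ refl = n≮0 (<-≤-trans 0<n n≤4d)
  intersection-nonzero _ n d@(suc d-1) D _ 6<D n≤4d lower refl = <⇒≱ 6<D (*-cancelˡ-≤ (d * d) (begin
    d * d * D              ≤⟨ lower ⟩
    d * d + d * d + n      ≤⟨ +-monoʳ-≤ (d * d + d * d) (≤-trans n≤4d (*-monoʳ-≤ 4 (m≤m*n d d))) ⟩
    d * d + d * d + 4 * (d * d) ≡⟨ collect (d * d) ⟩
    d * d * 6              ∎))
    where
    open ≤-Reasoning
    open +-*-Solver
    collect : ∀ s → s + s + 4 * s ≡ s * 6
    collect = solve 1 (λ s → s :+ s :+ con 4 :* s := s :* con 6) refl

  -- The floor costs less than one unit of d and the subtracted 1 costs another; scaled by 1000 they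
  -- make up the 2000.
  degree-bound : ∀ m d → m / 1000 ∸ 1 ≤ d → m ≤ 1000 * d + 2000
  degree-bound m d le = begin
    m                           ≡⟨ m≡m%n+[m/n]*n m 1000 ⟩
    m % 1000 + m / 1000 * 1000  ≤⟨ +-mono-≤ (<⇒≤ (m%n<n m 1000))
                                     (*-monoˡ-≤ 1000 (≤-trans (m≤n+m∸n (m / 1000) 1) (+-monoʳ-≤ 1 le))) ⟩
    1000 + (1 + d) * 1000       ≡⟨ regroup 1000 d ⟩
    1000 * d + (1000 + 1000)    ∎
    where
    open ≤-Reasoning
    open +-*-Solver
    regroup : ∀ k d → k + (1 + d) * k ≡ k * d + (k + k)
    regroup = solve 2 (λ k d → k :+ (con 1 :+ d) :* k := k :* d :+ (k :+ k)) refl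

-- From an estimate between reals to bounds between natural numbers

module RationalEstimates where

  open import Data.Integer.Base as ℤ using (+_)
  import Data.Integer.Properties as ℤ
  open import Data.Nat.Base as ℕ using (ℕ; suc; NonZero)
  open import Data.Product.Base using (_,_)
  open import Data.Rational.Base as ℚ using (ℚ; 0ℚ; 1ℚ; toℚᵘ)
  open import Data.Rational.Solver using (module +-*-Solver)
  open import Data.Rational.Unnormalised.Base as ℚᵘ using (mkℚᵘ; *≡*; *≤*)
  import Data.Rational.Unnormalised.Properties as ℚᵘ
  open import Data.Sum.Base using (inj₁; inj₂)

  -- An inequality of reals controls approximants only up to a tolerance. Taking it to be `δ` in
  -- both hypotheses enlarges the factor to `δ + δ` and adds a final `δ`; a common index makes both
  -- bounds speak of the same approximant of `x`.
  ≤ᴿ-scaled : ∀ {x X Q δ} → 0ℚ ℚ.< δ → 0ℚ ℚ.≤ Q → fromℚ X ≤ᴿ x *ᴿ fromℚ Q → x ≤ᴿ fromℚ δ →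
              X ℚ.≤ (δ ℚ.+ δ) ℚ.* Q ℚ.+ δ
  ≤ᴿ-scaled {x} {X} {Q} {δ} 0<δ 0≤Q X≤xQ x≤δ with X≤xQ δ 0<δ | x≤δ δ 0<δ
  ... | M , bound | N , small = ℚ.≤-trans (bound k (ℕ.m≤m⊔n M N))
    (ℚ.+-monoˡ-≤ δ (ℚ.*-monoʳ-≤-nonNeg Q {{ℚ.nonNegative 0≤Q}} (small k (ℕ.m≤n⊔m M N))))
    where k = M ℕ.⊔ N

  ι : ℕ → ℚ
  ι a = + a ℚ./ 1

  -- Normalised fractions with variable numerators do not compute, so identities about `ι` are
  -- checked on unnormalised fractions, where they are equations between integers.
  toℚᵘ-/ : ∀ a m .{{_ : NonZero m}} → toℚᵘ (+ a ℚ./ m) ℚᵘ.≃ (+ a) ℚᵘ./ m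
  toℚᵘ-/ a (suc m) = ℚ.toℚᵘ-fromℚᵘ (mkℚᵘ (+ a) m)

  ι-+ : ∀ a b → ι (a ℕ.+ b) ≡ ι a ℚ.+ ι b
  ι-+ a b = ℚ.toℚᵘ-injective (begin
    toℚᵘ (ι (a ℕ.+ b))          ≈⟨ toℚᵘ-/ (a ℕ.+ b) 1 ⟩
    mkℚᵘ (+ (a ℕ.+ b)) 0        ≈⟨ *≡* (cong (ℤ._* + 1) (trans (ℤ.pos-+ a b)
                                      (sym (cong₂ ℤ._+_ (ℤ.*-identityʳ (+ a)) (ℤ.*-identityʳ (+ b)))))) ⟩
    mkℚᵘ (+ a) 0 ℚᵘ.+ mkℚᵘ (+ b) 0 ≈⟨ ℚᵘ.+-cong (toℚᵘ-/ a 1) (toℚᵘ-/ b 1) ⟨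
    toℚᵘ (ι a) ℚᵘ.+ toℚᵘ (ι b)  ≈⟨ ℚ.toℚᵘ-homo-+ (ι a) (ι b) ⟨
    toℚᵘ (ι a ℚ.+ ι b)          ∎)
    where open ℚᵘ.≃-Reasoning

  ι-* : ∀ a b → ι (a ℕ.* b) ≡ ι a ℚ.* ι b
  ι-* a b = ℚ.toℚᵘ-injective (begin
    toℚᵘ (ι (a ℕ.* b))          ≈⟨ toℚᵘ-/ (a ℕ.* b) 1 ⟩
    mkℚᵘ (+ (a ℕ.* b)) 0        ≈⟨ *≡* (cong (ℤ._* + 1) (ℤ.pos-* a b)) ⟩
    mkℚᵘ (+ a) 0 ℚᵘ.* mkℚᵘ (+ b) 0 ≈⟨ ℚᵘ.*-cong (toℚᵘ-/ a 1) (toℚᵘ-/ b 1) ⟨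
    toℚᵘ (ι a) ℚᵘ.* toℚᵘ (ι b)  ≈⟨ ℚ.toℚᵘ-homo-* (ι a) (ι b) ⟨
    toℚᵘ (ι a ℚ.* ι b)          ∎)
    where open ℚᵘ.≃-Reasoning

  /-*-ι : ∀ a m .{{_ : NonZero m}} → (+ a ℚ./ m) ℚ.* ι m ≡ ι a
  /-*-ι a m@(suc _) = ℚ.toℚᵘ-injective (begin
    toℚᵘ ((+ a ℚ./ m) ℚ.* ι m)        ≈⟨ ℚ.toℚᵘ-homo-* (+ a ℚ./ m) (ι m) ⟩
    toℚᵘ (+ a ℚ./ m) ℚᵘ.* toℚᵘ (ι m)  ≈⟨ ℚᵘ.*-cong (toℚᵘ-/ a m) (toℚᵘ-/ m 1) ⟩
    ((+ a) ℚᵘ./ m) ℚᵘ.* mkℚᵘ (+ m) 0  ≈⟨ *≡* (trans (ℤ.*-identityʳ (+ a ℤ.* + m))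
                                               (cong (λ k → + a ℤ.* + k) (sym (ℕ.*-identityʳ m)))) ⟩
    mkℚᵘ (+ a) 0                      ≈⟨ toℚᵘ-/ a 1 ⟨
    toℚᵘ (ι a)                        ∎)
    where open ℚᵘ.≃-Reasoning

  ι-cancel-≤ : ∀ {a b} → ι a ℚ.≤ ι b → a ℕ.≤ b
  ι-cancel-≤ {a} {b} le with ℚᵘ.≤-respˡ-≃ (toℚᵘ-/ a 1) (ℚᵘ.≤-respʳ-≃ (toℚᵘ-/ b 1) (ℚ.toℚᵘ-mono-≤ le))
  ... | *≤* a≤b = ℤ.drop‿+≤+ (subst₂ ℤ._≤_ (ℤ.*-identityʳ (+ a)) (ℤ.*-identityʳ (+ b)) a≤b)

  0≤/ : ∀ a m .{{_ : NonZero m}} → 0ℚ ℚ.≤ + a ℚ./ m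
  0≤/ a m = ℚ.nonNegative⁻¹ _ {{ℚ.normalize-nonNeg a m}}

  p≤∣p∣ : ∀ p → p ℚ.≤ ℚ.∣ p ∣
  p≤∣p∣ p with ℚ.≤-total 0ℚ p
  ... | inj₁ 0≤p = ℚ.≤-reflexive (sym (ℚ.0≤p⇒∣p∣≡p 0≤p))
  ... | inj₂ p≤0 = ℚ.≤-trans p≤0 (ℚ.0≤∣p∣ p)

  ∣p-q∣≤r⇒p≤q+r : ∀ p q {r} → ℚ.∣ p ℚ.- q ∣ ℚ.≤ r → p ℚ.≤ q ℚ.+ r
  ∣p-q∣≤r⇒p≤q+r p q le = subst (ℚ._≤ q ℚ.+ _) (cancel p q)
    (ℚ.+-monoʳ-≤ q (ℚ.≤-trans (p≤∣p∣ (p ℚ.- q)) le))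
    where
    open +-*-Solver
    cancel : ∀ p q → q ℚ.+ (p ℚ.- q) ≡ p
    cancel = solve 2 (λ p q → q :+ (p :- q) := p) refl

  ∣p-q∣≡∣q-p∣ : ∀ p q → ℚ.∣ p ℚ.- q ∣ ≡ ℚ.∣ q ℚ.- p ∣
  ∣p-q∣≡∣q-p∣ p q = trans (sym (ℚ.∣-p∣≡∣p∣ (p ℚ.- q))) (cong ℚ.∣_∣ (flip p q))
    where
    open +-*-Solver
    flip : ∀ p q → ℚ.- (p ℚ.- q) ≡ q ℚ.- p
    flip = solve 2 (λ p q → :- (p :- q) := q :- p) refl

  -- Multiplication by n D removes every denominator. For s = d² and δ = 1/D, the error 2δ s/n + δ
  -- becomes 2 s + n.
  module Clearing (c s n D : ℕ) .{{_ : NonZero n}} .{{_ : NonZero D}}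
    (close : ℚ.∣ ι c ℚ.- (+ s ℚ./ n) ∣ ℚ.≤
             ((+ 1 ℚ./ D) ℚ.+ (+ 1 ℚ./ D)) ℚ.* (+ s ℚ./ n) ℚ.+ (+ 1 ℚ./ D)) where

    private
      δ = + 1 ℚ./ D
      Q = + s ℚ./ n

    clear : ∀ {p q} → p ℚ.≤ q ℚ.+ ((δ ℚ.+ δ) ℚ.* Q ℚ.+ δ) →
      p ℚ.* ι n ℚ.* ι D ℚ.≤ q ℚ.* ι n ℚ.* ι D ℚ.+ (ι s ℚ.+ ι s ℚ.+ ι n)
    clear {p} {q} le = subst (p ℚ.* ι n ℚ.* ι D ℚ.≤_) (begin
      (q ℚ.+ ((δ ℚ.+ δ) ℚ.* Q ℚ.+ δ)) ℚ.* ι n ℚ.* ι D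
        ≡⟨ solve 5 (λ q δ Q n D → (q :+ ((δ :+ δ) :* Q :+ δ)) :* n :* D :=
             q :* n :* D :+ ((δ :* D) :* (Q :* n) :+ (δ :* D) :* (Q :* n) :+ (δ :* D) :* n)) refl q δ Q (ι n) (ι D) ⟩
      q ℚ.* ι n ℚ.* ι D ℚ.+ ((δ ℚ.* ι D) ℚ.* (Q ℚ.* ι n) ℚ.+ (δ ℚ.* ι D) ℚ.* (Q ℚ.* ι n) ℚ.+ (δ ℚ.* ι D) ℚ.* ι n)
        ≡⟨ cong₂ (λ u v → q ℚ.* ι n ℚ.* ι D ℚ.+ (u ℚ.* v ℚ.+ u ℚ.* v ℚ.+ u ℚ.* ι n)) (/-*-ι 1 D) (/-*-ι s n) ⟩
      q ℚ.* ι n ℚ.* ι D ℚ.+ (1ℚ ℚ.* ι s ℚ.+ 1ℚ ℚ.* ι s ℚ.+ 1ℚ ℚ.* ι n)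
        ≡⟨ cong₂ (λ u v → q ℚ.* ι n ℚ.* ι D ℚ.+ (u ℚ.+ u ℚ.+ v)) (ℚ.*-identityˡ (ι s)) (ℚ.*-identityˡ (ι n)) ⟩
      q ℚ.* ι n ℚ.* ι D ℚ.+ (ι s ℚ.+ ι s ℚ.+ ι n) ∎)
      (ℚ.*-monoʳ-≤-nonNeg (ι D) {{ℚ.normalize-nonNeg D 1}}
        (ℚ.*-monoʳ-≤-nonNeg (ι n) {{ℚ.normalize-nonNeg n 1}} le))
      where
      open ≡-Reasoning
      open +-*-Solver

    ι-sum : ∀ a → ι (a ℕ.+ (s ℕ.+ s ℕ.+ n)) ≡ ι a ℚ.+ (ι s ℚ.+ ι s ℚ.+ ι n)
    ι-sum a = trans (ι-+ a _) (cong (ι a ℚ.+_) (trans (ι-+ (s ℕ.+ s) n) (cong (ℚ._+ ι n) (ι-+ s s))))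

    ι-product : ι (c ℕ.* n ℕ.* D) ≡ ι c ℚ.* ι n ℚ.* ι D
    ι-product = trans (ι-* (c ℕ.* n) D) (cong (ℚ._* ι D) (ι-* c n))

    ι-cleared : ι (s ℕ.* D) ≡ Q ℚ.* ι n ℚ.* ι D
    ι-cleared = trans (ι-* s D) (cong (ℚ._* ι D) (sym (/-*-ι s n)))

    upper : c ℕ.* n ℕ.* D ℕ.≤ s ℕ.* D ℕ.+ (s ℕ.+ s ℕ.+ n)
    upper = ι-cancel-≤ (subst₂ ℚ._≤_ (sym ι-product)
      (trans (cong (ℚ._+ (ι s ℚ.+ ι s ℚ.+ ι n)) (sym ι-cleared)) (sym (ι-sum (s ℕ.* D))))
      (clear {ι c} {Q} (∣p-q∣≤r⇒p≤q+r (ι c) Q close)))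

    lower : s ℕ.* D ℕ.≤ c ℕ.* n ℕ.* D ℕ.+ (s ℕ.+ s ℕ.+ n)
    lower = ι-cancel-≤ (subst₂ ℚ._≤_ (sym ι-cleared)
      (trans (cong (ℚ._+ (ι s ℚ.+ ι s ℚ.+ ι n)) (sym ι-product)) (sym (ι-sum (c ℕ.* n ℕ.* D))))
      (clear {Q} {ι c} (∣p-q∣≤r⇒p≤q+r Q (ι c) (subst (ℚ._≤ _) (∣p-q∣≡∣q-p∣ (ι c) Q) close))))

module Voting where

  open import Algebra.Definitions.RawMonoid ℚ.+-0-rawMonoid using () renaming (_×_ to _·_)
  open import Algebra.Definitions.RawMonoid ℚ.*-1-rawMonoid using () renaming (_×_ to _⋆_)
  open import Algebra.Properties.CommutativeMonoid.Sum using (sum-permute)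
  open import Algebra.Properties.CommutativeMonoid.Sum ℚ.+-0-commutativeMonoid
    using (sum; sum-cong-≗; sum-replicate-zero; ∑-distrib-+)
  open import Algebra.Properties.Group using (∙-cancelʳ)
  open import Data.Bool.Base using (Bool; true; false; if_then_else_; not)
  open import Data.Fin.Base using (Fin; zero; suc)
  open import Data.Fin.Permutation using (Permutation′; _⟨$⟩ˡ_; _⟨$⟩ʳ_; flip; inverseˡ; inverseʳ)
  open import Data.Fin.Properties using (any?; all?) renaming (_≟_ to _≟ᶠ_)
  open import Data.Fin.Subset using (Subset; Side; inside; outside; _∈_; ∣_∣; ∁; _∪_; _∩_; ⁅_⁆)
  open import Data.Fin.Subset.Properties
    using ( _∈?_; ∣∁p∣≡n∸∣p∣; ∪-identityʳ; p⊆q⇒∣p∣≤∣q∣; p⊂q⇒∣p∣<∣q∣; x∈p∪q⁻; x∈p∪q⁺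
          ; x∈⁅x⁆; x∈⁅y⁆⇒x≡y; ∣⁅x⁆∣≡1; ⊆-antisym )
  import Data.Integer.Base as ℤ
  open import Data.List.Base
    using (List; []; _∷_; allFin; applyUpTo; cartesianProductWith; filter; head; upTo)
  open import Data.List.Extrema ≤∞-totalOrder using (max≤v⁺; xs≤max)
  open import Data.List.Membership.Propositional.Properties using (∈-allFin; ∈-cartesianProductWith⁺)
  import Data.List.Relation.Unary.All as All
  open import Data.List.Relation.Unary.All.Properties using (cartesianProductWith⁺)
  import Data.Maybe.Base as Maybe
  open import Data.Nat.Base as ℕ using (ℕ; zero; suc; pred; _∸_; s≤s; z≤n; ⌈_/2⌉)
  open import Data.Nat.DivMod using (_%_; [m+kn]%n≡m%n)
  open import Data.Product.Base using (_×_; _,_; proj₁; proj₂; ∃-syntax)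
  open import Data.Rational.Base as ℚ using (ℚ; 0ℚ)
  open import Data.Rational.Solver using (module +-*-Solver)
  open import Data.Sign.Base using (Sign; +; -; opposite)
  open import Data.Sign.Properties using () renaming (_≟_ to _≟ˢ_)
  open import Data.Sum.Base using (_⊎_; inj₁; inj₂; [_,_]′)
  open import Data.Vec.Base using (Vec; []; _∷_; count; lookup; map; here; there)
  open import Data.Vec.Properties
    using ( lookup-map; []=⇒lookup; lookup⇒[]=; lookup∘tabulate; tabulate-cong; tabulate∘lookup
          ; lookup∘updateAt; lookup∘updateAt′; count≤n )
  open import Function.Base using (id; _∘_)
  open import Function.Bundles using (_⇔_; mk⇔; Equivalence)
  open import Level using (0ℓ)
  open import Relation.Binary.Definitions using (tri<; tri≈; tri>)
  import Relation.Binary.Construct.Add.Supremum.NonStrict ℕ._≤_ as ⁺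
  open ⁺ using () renaming ([_] to ≤[_])
  open import Relation.Nullary.Construct.Add.Supremum using ([_])
  open import Relation.Nullary.Decidable
    using (Dec; yes; no; does; _→-dec_; does-⇔; dec-true; dec-false; decidable-stable)
  open import Relation.Nullary.Negation using (¬_; contradiction)
  open import Relation.Unary using (Pred; Decidable)

  private
    variable
      n : ℕ

  -- Weighted sums over the cube

  ‖_‖ : Vec Sign n → ℕ
  ‖ x ‖ = count (+ ≟ˢ_) x

  gate : Bool → ℚ → ℚ
  gate b q = if b then q else 0ℚ

  gate-0 : ∀ b → gate b 0ℚ ≡ 0ℚ
  gate-0 true  = refl
  gate-0 false = refl

  interchange : ∀ a b c d → (a ℚ.+ b) ℚ.+ (c ℚ.+ d) ≡ (a ℚ.+ c) ℚ.+ (b ℚ.+ d)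
  interchange = solve 4 (λ a b c d → (a :+ b) :+ (c :+ d) := (a :+ c) :+ (b :+ d)) refl
    where open +-*-Solver

  -- Influences are compared one approximant at a time, so the sum over the cube is repeated with
  -- rational values.
  cubeSum : (Vec Sign n → ℚ) → ℚ
  cubeSum {zero}  f = f []
  cubeSum {suc n} f = cubeSum (λ x → f (- ∷ x)) ℚ.+ cubeSum (λ x → f (+ ∷ x))

  approx-sumCube : (f : Vec Sign n → ℝ) → ∀ k →
                   approx (sumCube f) k ≡ cubeSum (λ x → approx (f x) k)
  approx-sumCube {zero}  f k = refl
  approx-sumCube {suc n} f k = cong₂ ℚ._+_
    (approx-sumCube (λ x → f (- ∷ x)) k) (approx-sumCube (λ x → f (+ ∷ x)) k)

  cubeSum-cong : {f g : Vec Sign n → ℚ} → f ≗ g → cubeSum f ≡ cubeSum g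
  cubeSum-cong {zero}  f≗g = f≗g []
  cubeSum-cong {suc n} f≗g = cong₂ ℚ._+_
    (cubeSum-cong λ x → f≗g (- ∷ x)) (cubeSum-cong λ x → f≗g (+ ∷ x))

  cubeSum-0 : ∀ n → cubeSum {n} (λ _ → 0ℚ) ≡ 0ℚ
  cubeSum-0 zero    = refl
  cubeSum-0 (suc n) = cong₂ ℚ._+_ (cubeSum-0 n) (cubeSum-0 n)

  cubeSum-+ : (f g : Vec Sign n → ℚ) →
              cubeSum (λ x → f x ℚ.+ g x) ≡ cubeSum f ℚ.+ cubeSum g
  cubeSum-+ {zero}  f g = refl
  cubeSum-+ {suc n} f g = trans
    (cong₂ ℚ._+_ (cubeSum-+ (λ x → f (- ∷ x)) (λ x → g (- ∷ x)))
                 (cubeSum-+ (λ x → f (+ ∷ x)) (λ x → g (+ ∷ x))))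
    (interchange (cubeSum λ x → f (- ∷ x)) (cubeSum λ x → g (- ∷ x))
                 (cubeSum λ x → f (+ ∷ x)) (cubeSum λ x → g (+ ∷ x)))

  cubeSum-∑ : ∀ {m} (f : Vec Sign n → Fin m → ℚ) →
              cubeSum (λ x → sum (f x)) ≡ sum (λ v → cubeSum (λ x → f x v))
  cubeSum-∑ {zero}  f = refl
  cubeSum-∑ {suc n} f = trans
    (cong₂ ℚ._+_ (cubeSum-∑ (λ x → f (- ∷ x))) (cubeSum-∑ (λ x → f (+ ∷ x))))
    (sym (∑-distrib-+ (λ v → cubeSum λ x → f (- ∷ x) v) (λ v → cubeSum λ x → f (+ ∷ x) v)))

  cubeSum-opposite : (f : Vec Sign n → ℚ) → cubeSum (f ∘ map opposite) ≡ cubeSum f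
  cubeSum-opposite {zero}  f = refl
  cubeSum-opposite {suc n} f = trans
    (cong₂ ℚ._+_ (cubeSum-opposite (λ x → f (+ ∷ x))) (cubeSum-opposite (λ x → f (- ∷ x))))
    (ℚ.+-comm (cubeSum λ x → f (+ ∷ x)) (cubeSum λ x → f (- ∷ x)))

  cubeSum-⊕ : (i : Fin n) (f : Vec Sign n → ℚ) → cubeSum (λ x → f (x ⊕ i)) ≡ cubeSum f
  cubeSum-⊕ zero    f = ℚ.+-comm (cubeSum λ x → f (+ ∷ x)) (cubeSum λ x → f (- ∷ x))
  cubeSum-⊕ (suc i) f = cong₂ ℚ._+_
    (cubeSum-⊕ i (λ x → f (- ∷ x))) (cubeSum-⊕ i (λ x → f (+ ∷ x)))

  unanimous? : ∀ y (S : Subset n) → Decidable (λ x → Unanimous y x S)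
  unanimous? y S x = all? λ i → (i ∈? S) →-dec (lookup x i ≟ˢ y)

  unanimous-outside : ∀ {y s} {x : Vec Sign n} {S} →
                      Unanimous y x S ⇔ Unanimous y (s ∷ x) (outside ∷ S)
  unanimous-outside = mk⇔ (λ { u (suc i) (there i∈S) → u i i∈S }) (λ u i i∈S → u (suc i) (there i∈S))

  unanimous-inside : ∀ {y} {x : Vec Sign n} {S} →
                     Unanimous y x S ⇔ Unanimous y (y ∷ x) (inside ∷ S)
  unanimous-inside = mk⇔ (λ { u zero _ → refl ; u (suc i) (there i∈S) → u i i∈S })
                         (λ u i i∈S → u (suc i) (there i∈S))

  -- The weight treats all levels at once: the indicator of k counts supersets of size k, and a
  -- binomial weight gives the measure of all supersets.
  supersetSum : Subset n → (ℕ → ℚ) → ℚ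
  supersetSum S h = cubeSum λ x → gate (does (unanimous? + S x)) (h ‖ x ‖)

  -- A superset of S is S together with an arbitrary subset of its complement.
  supersetSum-∁ : (S : Subset n) (h : ℕ → ℚ) →
    supersetSum S h ≡ cubeSum {∣ ∁ S ∣} (λ y → h (∣ S ∣ ℕ.+ ‖ y ‖))
  supersetSum-∁ []            h = refl
  supersetSum-∁ {suc n} (outside ∷ S) h = cong₂ ℚ._+_
    (trans (cubeSum-cong λ x → cong (λ b → gate b (h ‖ x ‖)) (sym (does-⇔ unanimous-outside
              (unanimous? + S x) (unanimous? + (outside ∷ S) (- ∷ x)))))
           (supersetSum-∁ S h))
    (trans (cubeSum-cong λ x → cong (λ b → gate b (h (suc ‖ x ‖))) (sym (does-⇔ unanimous-outside
              (unanimous? + S x) (unanimous? + (outside ∷ S) (+ ∷ x)))))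
    (trans (supersetSum-∁ S (h ∘ suc))
           (cubeSum-cong {∣ ∁ S ∣} λ y → cong h (sym (ℕ.+-suc ∣ S ∣ ‖ y ‖)))))
  supersetSum-∁ {suc n} (inside ∷ S) h = trans (cong₂ ℚ._+_
    (trans (cubeSum-cong λ x → cong (λ b → gate b (h ‖ x ‖))
              (dec-false (unanimous? + (inside ∷ S) (- ∷ x)) (λ u → case-absurd (u zero here))))
           (cubeSum-0 n))
    (trans (cubeSum-cong λ x → cong (λ b → gate b (h (suc ‖ x ‖))) (sym (does-⇔ unanimous-inside
              (unanimous? + S x) (unanimous? + (inside ∷ S) (+ ∷ x)))))
           (supersetSum-∁ S (h ∘ suc))))
    (ℚ.+-identityˡ _)
    where
    case-absurd : - ≢ +
    case-absurd ()

  ∑-bool : (S : Subset n) (f : Bool → ℚ) →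
           sum (λ v → f (lookup S v)) ≡ (∣ S ∣ · f true) ℚ.+ (∣ ∁ S ∣ · f false)
  ∑-bool []            f = refl
  ∑-bool (inside ∷ S)  f = trans (cong (f true ℚ.+_) (∑-bool S f)) (sym (ℚ.+-assoc (f true) _ _))
  ∑-bool (outside ∷ S) f = trans (cong (f false ℚ.+_) (∑-bool S f))
    (solve 3 (λ a b c → c :+ (a :+ b) := a :+ (c :+ b)) refl (∣ S ∣ · f true) (∣ ∁ S ∣ · f false) (f false))
    where open +-*-Solver

  -- Reflection and the majority vote

  ‖‖-opposite : (x : Vec Sign n) → ‖ map opposite x ‖ ≡ count (- ≟ˢ_) x
  ‖‖-opposite []      = refl
  ‖‖-opposite (- ∷ x) = cong suc (‖‖-opposite x)
  ‖‖-opposite (+ ∷ x) = ‖‖-opposite x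

  ‖‖-complement : (x : Vec Sign n) → ‖ map opposite x ‖ ℕ.+ ‖ x ‖ ≡ n
  ‖‖-complement []      = refl
  ‖‖-complement (- ∷ x) = cong suc (‖‖-complement x)
  ‖‖-complement (+ ∷ x) = trans (ℕ.+-suc _ ‖ x ‖) (cong suc (‖‖-complement x))

  +-≤ˢ : ∀ {s} → + ≤ˢ s → s ≡ +
  +-≤ˢ {+} _ = refl

  ≤ˢ-- : ∀ {s} → s ≤ˢ - → s ≡ -
  ≤ˢ-- { - } _ = refl

  -≤ˢs : ∀ s → - ≤ˢ s
  -≤ˢs - = ℤ.-≤- z≤n
  -≤ˢs + = ℤ.-≤+

  s≤ˢ+ : ∀ s → s ≤ˢ +
  s≤ˢ+ - = ℤ.-≤+
  s≤ˢ+ + = ℤ.+≤+ (s≤s z≤n)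

  ‖‖-mono : (x′ x : Vec Sign n) → (∀ i → lookup x′ i ≤ˢ lookup x i) → ‖ x′ ‖ ℕ.≤ ‖ x ‖
  ‖‖-mono []       []      _  = z≤n
  ‖‖-mono (- ∷ x′) (- ∷ x) le = ‖‖-mono x′ x (le ∘ suc)
  ‖‖-mono (- ∷ x′) (+ ∷ x) le = ℕ.m≤n⇒m≤1+n (‖‖-mono x′ x (le ∘ suc))
  ‖‖-mono (+ ∷ x′) (+ ∷ x) le = s≤s (‖‖-mono x′ x (le ∘ suc))
  ‖‖-mono (+ ∷ x′) (- ∷ x) le = contradiction (+-≤ˢ (le zero)) λ ()

  Minority Majority : Vec Sign n → Set
  Minority {n} x = ‖ x ‖ ℕ.+ ‖ x ‖ ℕ.< n
  Majority {n} x = n ℕ.< ‖ x ‖ ℕ.+ ‖ x ‖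

  minority-opposite : (x : Vec Sign n) → Majority x → Minority (map opposite x)
  minority-opposite {n} x n<2x = subst (‖ map opposite x ‖ ℕ.+ ‖ map opposite x ‖ ℕ.<_) (‖‖-complement x)
    (ℕ.+-monoʳ-< ‖ map opposite x ‖ (ℕ.+-cancelʳ-< ‖ x ‖ _ _
      (subst (ℕ._< ‖ x ‖ ℕ.+ ‖ x ‖) (sym (‖‖-complement x)) n<2x)))

  majority-opposite : (x : Vec Sign n) → Minority x → Majority (map opposite x)
  majority-opposite {n} x 2x<n = subst (ℕ._< ‖ map opposite x ‖ ℕ.+ ‖ map opposite x ‖) (‖‖-complement x)
    (ℕ.+-monoʳ-< ‖ map opposite x ‖ (ℕ.+-cancelʳ-< ‖ x ‖ _ _
      (subst (‖ x ‖ ℕ.+ ‖ x ‖ ℕ.<_) (sym (‖‖-complement x)) 2x<n)))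

  odd≢m+m : n % 2 ≡ 1 → ∀ m → m ℕ.+ m ≢ n
  odd≢m+m odd m refl = contradiction (trans (sym odd) even) λ ()
    where
    even : (m ℕ.+ m) % 2 ≡ 0
    even = subst (λ k → k % 2 ≡ 0)
      (trans (ℕ.*-comm m 2) (cong (m ℕ.+_) (ℕ.+-identityʳ m))) ([m+kn]%n≡m%n 0 m 2)

  minority-or-majority : n % 2 ≡ 1 → (x : Vec Sign n) → Minority x ⊎ Majority x
  minority-or-majority {n} odd x with ℕ.<-cmp (‖ x ‖ ℕ.+ ‖ x ‖) n
  ... | tri< lt _ _ = inj₁ lt
  ... | tri≈ _ eq _ = contradiction eq (odd≢m+m odd ‖ x ‖)
  ... | tri> _ _ gt = inj₂ gt

  maj-majority : (x : Vec Sign n) → Majority x → maj x ≡ +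
  maj-majority x n<2x = cong (λ b → if b then + else -)
    (dec-true (count (- ≟ˢ_) x ℕ.<? ‖ x ‖) (subst (ℕ._< ‖ x ‖) (‖‖-opposite x)
      (ℕ.+-cancelʳ-< ‖ x ‖ _ _ (subst (ℕ._< ‖ x ‖ ℕ.+ ‖ x ‖) (sym (‖‖-complement x)) n<2x))))

  maj-minority : (x : Vec Sign n) → Minority x → maj x ≡ -
  maj-minority x 2x<n = cong (λ b → if b then + else -)
    (dec-false (count (- ≟ˢ_) x ℕ.<? ‖ x ‖) (ℕ.<-asym (subst (‖ x ‖ ℕ.<_) (‖‖-opposite x)
      (ℕ.+-cancelʳ-< ‖ x ‖ _ _ (subst (‖ x ‖ ℕ.+ ‖ x ‖ ℕ.<_) (sym (‖‖-complement x)) 2x<n)))))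

  maj-opposite : n % 2 ≡ 1 → IsOdd (maj {n})
  maj-opposite odd x with minority-or-majority odd x
  ... | inj₁ lo = trans (maj-majority (map opposite x) (majority-opposite x lo))
                        (cong opposite (sym (maj-minority x lo)))
  ... | inj₂ hi = trans (maj-minority (map opposite x) (minority-opposite x hi))
                        (cong opposite (sym (maj-majority x hi)))

  maj-mono : n % 2 ≡ 1 → IsMonotone (maj {n})
  maj-mono odd x x′ le with minority-or-majority odd x
  ... | inj₂ hi = subst (maj x′ ≤ˢ_) (sym (maj-majority x hi)) (s≤ˢ+ (maj x′))
  ... | inj₁ lo = subst (_≤ˢ maj x) (sym (maj-minority x′ (ℕ.≤-<-trans
    (ℕ.+-mono-≤ (‖‖-mono x′ x le) (‖‖-mono x′ x le)) lo))) (-≤ˢs (maj x))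

  -- Rules decided by a family of coalitions

  -- For `β = ball G (rad G)` the rule `Φ` unfolds to `graphicRule G`. With the family as a
  -- parameter, the radius can later be replaced by 1 by a single substitution.
  module CoalitionRule {n} (β : Fin n → Subset n) where

    HasUnanimous : Sign → Vec Sign n → Set
    HasUnanimous y x = ∃[ v ] Unanimous y x (β v)

    hasUnanimous? : ∀ y x → Dec (HasUnanimous y x)
    hasUnanimous? y x = any? λ v → unanimous? y (β v) x

    Φ : VotingRule n
    Φ x =
      if does (hasUnanimous? + x) then + else
      if does (hasUnanimous? - x) then - else
      maj x

    Φ-maj : ∀ x → (∀ y → ¬ HasUnanimous y x) → Φ x ≡ maj x
    Φ-maj x none rewrite dec-false (hasUnanimous? + x) (none +)
                       | dec-false (hasUnanimous? - x) (none -) = refl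

    module Intersecting (meet : ∀ u v → ∃[ i ] (i ∈ β u × i ∈ β v)) where

      Φ-unanimous : ∀ y x → HasUnanimous y x → Φ x ≡ y
      Φ-unanimous + x has rewrite dec-true (hasUnanimous? + x) has = refl
      Φ-unanimous - x has@(v , x≡-)
        rewrite dec-false (hasUnanimous? + x) (λ (u , x≡+) → let i , i∈u , i∈v = meet u v in
                  contradiction (trans (sym (x≡+ i i∈u)) (x≡- i i∈v)) λ ())
              | dec-true (hasUnanimous? - x) has = refl

      data Outcome (x : Vec Sign n) : Set where
        unanimous : ∀ y → HasUnanimous y x → Outcome x
        neither   : (∀ y → ¬ HasUnanimous y x) → Outcome x

      outcome : ∀ x → Outcome x
      outcome x with hasUnanimous? + x | hasUnanimous? - x
      ... | yes has | _       = unanimous + has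
      ... | no _    | yes has = unanimous - has
      ... | no none+ | no none- = neither λ { + → none+ ; - → none- }

      hasUnanimous-opposite : ∀ {y} x → HasUnanimous y x → HasUnanimous (opposite y) (map opposite x)
      hasUnanimous-opposite x (v , u) = v , λ i i∈v → trans (lookup-map i opposite x) (cong opposite (u i i∈v))

      hasUnanimous-opposite⁻ : ∀ {y} x → HasUnanimous y (map opposite x) → HasUnanimous (opposite y) x
      hasUnanimous-opposite⁻ {y} x (v , u) = v , λ i i∈v → begin
        lookup x i                             ≡⟨ opposite-involutive (lookup x i) ⟨
        opposite (opposite (lookup x i))       ≡⟨ cong opposite (lookup-map i opposite x) ⟨
        opposite (lookup (map opposite x) i)   ≡⟨ cong opposite (u i i∈v) ⟩
        opposite y                             ∎
        where
        open ≡-Reasoning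
        opposite-involutive : ∀ s → opposite (opposite s) ≡ s
        opposite-involutive + = refl
        opposite-involutive - = refl

      Φ-odd : n % 2 ≡ 1 → IsOdd Φ
      Φ-odd odd x with outcome x
      ... | unanimous y has = trans (Φ-unanimous (opposite y) (map opposite x) (hasUnanimous-opposite x has))
                                    (cong opposite (sym (Φ-unanimous y x has)))
      ... | neither none = begin
        Φ (map opposite x)    ≡⟨ Φ-maj (map opposite x) (λ y → none (opposite y) ∘ hasUnanimous-opposite⁻ x) ⟩
        maj (map opposite x)  ≡⟨ maj-opposite odd x ⟩
        opposite (maj x)      ≡⟨ cong opposite (Φ-maj x none) ⟨
        opposite (Φ x)        ∎
        where open ≡-Reasoning

      Φ-mono : n % 2 ≡ 1 → IsMonotone Φ
      Φ-mono odd x x′ le with outcome x | outcome x′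
      ... | unanimous + has | _ = subst (Φ x′ ≤ˢ_) (sym (Φ-unanimous + x has)) (s≤ˢ+ (Φ x′))
      ... | _ | unanimous - has = subst (_≤ˢ Φ x) (sym (Φ-unanimous - x′ has)) (-≤ˢs (Φ x))
      ... | unanimous - (v , u) | _ = subst (_≤ˢ Φ x) (sym (Φ-unanimous - x′
              (v , λ i i∈v → ≤ˢ-- (subst (lookup x′ i ≤ˢ_) (u i i∈v) (le i))))) (-≤ˢs (Φ x))
      ... | _ | unanimous + (v , u) = subst (Φ x′ ≤ˢ_) (sym (Φ-unanimous + x
              (v , λ i i∈v → +-≤ˢ (subst (_≤ˢ lookup x i) (u i i∈v) (le i))))) (s≤ˢ+ (Φ x′))
      ... | neither none | neither none′ =
              subst₂ _≤ˢ_ (sym (Φ-maj x′ none′)) (sym (Φ-maj x none)) (maj-mono odd x x′ le)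

      -- Below n/2 the majority is `-`, and a coalition unanimous for `-` also yields `-`, so `+`
      -- has only one possible cause.
      minority-unanimous : ∀ x → Minority x → Φ x ≡ + → HasUnanimous + x
      minority-unanimous x lo Φx≡+ with outcome x
      ... | unanimous + has = has
      ... | unanimous - has = contradiction (trans (sym (Φ-unanimous - x has)) Φx≡+) λ ()
      ... | neither none    = contradiction
              (trans (sym (trans (Φ-maj x none) (maj-minority x lo))) Φx≡+) λ ()

      winning : ∀ v → IsWinningCoalition Φ (β v)
      winning v y x u = Φ-unanimous y x (v , u)

  -- Indicator vectors and automorphisms of coalition rules

  is+ : Sign → Bool
  is+ + = true
  is+ - = false

  positives : Vec Sign n → Subset n
  positives = map is+

  ∣positives∣ : (x : Vec Sign n) → ∣ positives x ∣ ≡ ‖ x ‖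
  ∣positives∣ []      = refl
  ∣positives∣ (+ ∷ x) = cong suc (∣positives∣ x)
  ∣positives∣ (- ∷ x) = ∣positives∣ x

  ∈-positives⁺ : ∀ (x : Vec Sign n) {i} → lookup x i ≡ + → i ∈ positives x
  ∈-positives⁺ x {i} x≡+ = lookup⇒[]= i _ (trans (lookup-map i is+ x) (cong is+ x≡+))

  ∣unanimous∣≤‖‖ : ∀ (x : Vec Sign n) {S} → Unanimous + x S → ∣ S ∣ ℕ.≤ ‖ x ‖
  ∣unanimous∣≤‖‖ x {S} u = subst (∣ S ∣ ℕ.≤_) (∣positives∣ x) (p⊆q⇒∣p∣≤∣q∣ λ i∈S → ∈-positives⁺ x (u _ i∈S))

  ∈-unanimous : ∀ (x : Vec Sign n) {S} → Unanimous + x S → ‖ x ‖ ≡ ∣ S ∣ →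
                ∀ {i} → lookup x i ≡ + → i ∈ S
  ∈-unanimous x {S} u tight {i} x≡+ = decidable-stable (i ∈? S) λ i∉S →
    ℕ.<-irrefl (trans (sym tight) (sym (∣positives∣ x)))
      (p⊂q⇒∣p∣<∣q∣ ((λ j∈S → ∈-positives⁺ x (u _ j∈S)) , i , ∈-positives⁺ x x≡+ , i∉S))

  ∣p∪q∣+∣p∩q∣ : (p q : Subset n) → ∣ p ∪ q ∣ ℕ.+ ∣ p ∩ q ∣ ≡ ∣ p ∣ ℕ.+ ∣ q ∣
  ∣p∪q∣+∣p∩q∣ []            []            = refl
  ∣p∪q∣+∣p∩q∣ (outside ∷ p) (outside ∷ q) = ∣p∪q∣+∣p∩q∣ p q
  ∣p∪q∣+∣p∩q∣ (outside ∷ p) (inside ∷ q)  = trans (cong suc (∣p∪q∣+∣p∩q∣ p q)) (sym (ℕ.+-suc ∣ p ∣ ∣ q ∣))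
  ∣p∪q∣+∣p∩q∣ (inside ∷ p)  (outside ∷ q) = cong suc (∣p∪q∣+∣p∩q∣ p q)
  ∣p∪q∣+∣p∩q∣ (inside ∷ p)  (inside ∷ q)  = cong suc
    (trans (ℕ.+-suc ∣ p ∪ q ∣ ∣ p ∩ q ∣) (trans (cong suc (∣p∪q∣+∣p∩q∣ p q)) (sym (ℕ.+-suc ∣ p ∣ ∣ q ∣))))

  ∣p∪⁅i⁆∣ : (p : Subset n) (i : Fin n) → ∣ p ∪ ⁅ i ⁆ ∣ ≡ (if lookup p i then ∣ p ∣ else suc ∣ p ∣)
  ∣p∪⁅i⁆∣ (outside ∷ p) zero    = cong (suc ∘ ∣_∣) (∪-identityʳ p)
  ∣p∪⁅i⁆∣ (inside ∷ p)  zero    = cong (suc ∘ ∣_∣) (∪-identityʳ p)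
  ∣p∪⁅i⁆∣ (outside ∷ p) (suc i) = ∣p∪⁅i⁆∣ p i
  ∣p∪⁅i⁆∣ (inside ∷ p)  (suc i) with lookup p i | ∣p∪⁅i⁆∣ p i
  ... | true  | eq = cong suc eq
  ... | false | eq = cong suc eq

  unanimous-∪ : ∀ {y} {x : Vec Sign n} {S T} → Unanimous y x S → Unanimous y x T → Unanimous y x (S ∪ T)
  unanimous-∪ {S = S} {T} u v i = [ u i , v i ]′ ∘ x∈p∪q⁻ S T

  fromSide : Side → Sign
  fromSide true  = +
  fromSide false = -

  signs : Subset n → Vec Sign n
  signs = map fromSide

  lookup-signs : ∀ {S : Subset n} {i} → i ∈ S ⇔ lookup (signs S) i ≡ +
  lookup-signs {S = S} {i} = mk⇔
    (λ i∈S → trans (lookup-map i fromSide S) (cong fromSide ([]=⇒lookup i∈S)))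
    (λ eq → lookup⇒[]= i S (fromSide-+ (trans (sym (lookup-map i fromSide S)) eq)))
    where
    fromSide-+ : ∀ {b} → fromSide b ≡ + → b ≡ true
    fromSide-+ {true} _ = refl

  ‖signs‖ : (S : Subset n) → ‖ signs S ‖ ≡ ∣ S ∣
  ‖signs‖ []            = refl
  ‖signs‖ (inside ∷ S)  = cong suc (‖signs‖ S)
  ‖signs‖ (outside ∷ S) = ‖signs‖ S

  module ℕ-Sum where
    open import Algebra.Properties.CommutativeMonoid.Sum ℕ.+-0-commutativeMonoid public using (sum; sum-cong-≗)

  ‖‖-sum : (x : Vec Sign n) → ‖ x ‖ ≡ ℕ-Sum.sum (λ i → if is+ (lookup x i) then 1 else 0)
  ‖‖-sum []      = refl
  ‖‖-sum (+ ∷ x) = cong suc (‖‖-sum x)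
  ‖‖-sum (- ∷ x) = ‖‖-sum x

  lookup-permute : (σ : Permutation′ n) (x : Vec Sign n) (i : Fin n) →
                   lookup (permute σ x) i ≡ lookup x (σ ⟨$⟩ˡ i)
  lookup-permute σ x = lookup∘tabulate λ i → lookup x (σ ⟨$⟩ˡ i)

  ‖permute‖ : (σ : Permutation′ n) (x : Vec Sign n) → ‖ permute σ x ‖ ≡ ‖ x ‖
  ‖permute‖ {n} σ x = begin
    ‖ permute σ x ‖
      ≡⟨ ‖‖-sum (permute σ x) ⟩
    ℕ-Sum.sum (λ i → if is+ (lookup (permute σ x) i) then 1 else 0)
      ≡⟨ ℕ-Sum.sum-cong-≗ {n} (λ i → cong (λ s → if is+ s then 1 else 0) (lookup-permute σ x i)) ⟩
    ℕ-Sum.sum (λ i → if is+ (lookup x (σ ⟨$⟩ˡ i)) then 1 else 0)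
      ≡⟨ sum-permute ℕ.+-0-commutativeMonoid (λ i → if is+ (lookup x i) then 1 else 0) (flip σ) ⟨
    ℕ-Sum.sum (λ i → if is+ (lookup x i) then 1 else 0)
      ≡⟨ ‖‖-sum x ⟨
    ‖ x ‖ ∎
    where open ≡-Reasoning

  permute-flip : (σ : Permutation′ n) (x : Vec Sign n) → permute (flip σ) (permute σ x) ≡ x
  permute-flip σ x = trans
    (tabulate-cong λ i → trans (lookup-permute σ x (σ ⟨$⟩ʳ i)) (cong (lookup x) (inverseˡ σ)))
    (tabulate∘lookup x)

  Aut-flip : ∀ {Φ : VotingRule n} {σ} → Aut Φ σ → Aut Φ (flip σ)
  Aut-flip {Φ = Φ} {σ} inv x = trans (sym (inv (permute σ x))) (cong Φ (permute-flip σ x))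

  module Automorphisms {n} (β : Fin n → Subset n) {s} (meet : ∀ u v → ∃[ i ] (i ∈ β u × i ∈ β v))
    (∣β∣ : ∀ v → ∣ β v ∣ ≡ s) (2s<n : s ℕ.+ s ℕ.< n) where

    open CoalitionRule β
    open Intersecting meet

    -- Pulling the indicator vector of `β v` back along `σ` keeps its level `s`, which is below n/2,
    -- and its value `+`. Its pluses therefore cover some `β w`, and equality of sizes turns this
    -- inclusion into equality.
    image-coalition : ∀ {σ} → Aut Φ σ → ∀ v → ∃[ w ] (∀ u → u ∈ β w ⇔ σ ⟨$⟩ʳ u ∈ β v)
    image-coalition {σ} inv v = w , λ u → mk⇔
      (λ u∈w → Equivalence.from lookup-signs (trans (sym (lookup-permute (flip σ) (signs (β v)) u)) (y≡+ u u∈w)))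
      (λ σu∈v → ∈-unanimous y y≡+ (trans ‖y‖≡s (sym (∣β∣ w)))
                  (trans (lookup-permute (flip σ) (signs (β v)) u) (Equivalence.to lookup-signs σu∈v)))
      where
      y = permute (flip σ) (signs (β v))
      ‖y‖≡s : ‖ y ‖ ≡ s
      ‖y‖≡s = trans (‖permute‖ (flip σ) (signs (β v))) (trans (‖signs‖ (β v)) (∣β∣ v))
      has : HasUnanimous + y
      has = minority-unanimous y (subst (λ k → k ℕ.+ k ℕ.< n) (sym ‖y‖≡s) 2s<n)
        (trans (inv (signs (β v))) (Φ-unanimous + (signs (β v)) (v , λ i → Equivalence.to lookup-signs)))
      w = proj₁ has
      y≡+ = proj₂ has

  -- Pivotal vectors of a monotone rule

  +-cancelʳ : ∀ r {p q} → p ℚ.+ r ≡ q ℚ.+ r → p ≡ q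
  +-cancelʳ r {p} {q} = ∙-cancelʳ ℚ.+-0-group r p q

  sum-zero : (f : Fin n → ℚ) → (∀ i → f i ≡ 0ℚ) → sum f ≡ 0ℚ
  sum-zero {n} f f≡0 = trans (sum-cong-≗ f≡0) (sum-replicate-zero n)

  sum-single : (f : Fin n → ℚ) (i : Fin n) → (∀ j → j ≢ i → f j ≡ 0ℚ) → sum f ≡ f i
  sum-single f zero    f≡0 = trans (cong (f zero ℚ.+_) (sum-zero (f ∘ suc) λ j → f≡0 (suc j) λ ()))
                                   (ℚ.+-identityʳ (f zero))
  sum-single f (suc i) f≡0 = trans (cong₂ ℚ._+_ (f≡0 zero λ ())
      (sum-single (f ∘ suc) i λ j j≢i → f≡0 (suc j) λ { refl → j≢i refl }))
    (ℚ.+-identityˡ (f (suc i)))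

  gate-+ : ∀ b p q → gate b (p ℚ.+ q) ≡ gate b p ℚ.+ gate b q
  gate-+ true  p q = refl
  gate-+ false p q = refl

  positiveTerm negativeTerm pivotalTerm : VotingRule n → (ℕ → ℚ) → Fin n → Vec Sign n → ℚ
  positiveTerm Φ h i x = gate (is+ (lookup x i)) (gate (is+ (Φ x)) (h ‖ x ‖))
  negativeTerm Φ h i x = gate (is+ (opposite (lookup x i))) (gate (is+ (Φ x)) (h ‖ x ‖))
  pivotalTerm  Φ h i x = gate (not (does (Φ x ≟ˢ Φ (x ⊕ i)))) (h ‖ x ‖)

  positiveSum negativeSum pivotalSum : VotingRule n → (ℕ → ℚ) → Fin n → ℚ
  positiveSum Φ h i = cubeSum (positiveTerm Φ h i)
  negativeSum Φ h i = cubeSum (negativeTerm Φ h i)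
  pivotalSum  Φ h i = cubeSum (pivotalTerm Φ h i)

  supersetSum-reduce : (S : Subset n) (h : ℕ → ℚ) →
    supersetSum S h ≡ cubeSum {n ∸ ∣ S ∣} (λ y → h (∣ S ∣ ℕ.+ ‖ y ‖))
  supersetSum-reduce S h = trans (supersetSum-∁ S h)
    (cong (λ m → cubeSum {m} λ y → h (∣ S ∣ ℕ.+ ‖ y ‖)) (∣∁p∣≡n∸∣p∣ S))

  supersetSum-card : (S T : Subset n) (h : ℕ → ℚ) → ∣ S ∣ ≡ ∣ T ∣ → supersetSum S h ≡ supersetSum T h
  supersetSum-card {n} S T h eq = begin
    supersetSum S h ≡⟨ supersetSum-reduce S h ⟩
    reduced ∣ S ∣   ≡⟨ cong reduced eq ⟩
    reduced ∣ T ∣   ≡⟨ supersetSum-reduce T h ⟨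
    supersetSum T h ∎
    where
    open ≡-Reasoning
    reduced : ℕ → ℚ
    reduced k = cubeSum {n ∸ k} λ y → h (k ℕ.+ ‖ y ‖)

  unanimous-⁅⁆ : ∀ (x : Vec Sign n) i → does (unanimous? + ⁅ i ⁆ x) ≡ is+ (lookup x i)
  unanimous-⁅⁆ x i with lookup x i in eq
  ... | + = dec-true (unanimous? + ⁅ i ⁆ x)
              λ j j∈ → trans (cong (lookup x) (x∈⁅y⁆⇒x≡y i j∈)) eq
  ... | - = dec-false (unanimous? + ⁅ i ⁆ x)
              λ u → contradiction (trans (sym eq) (u i (x∈⁅x⁆ i))) λ ()

  -- A plus at i means that the pluses contain the singleton of i; all singletons have the same
  -- size, so the cube need not be relabelled.
  coordinateSum : ∀ (h : ℕ → ℚ) (i j : Fin n) →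
    cubeSum (λ x → gate (is+ (lookup x i)) (h ‖ x ‖)) ≡ cubeSum (λ x → gate (is+ (lookup x j)) (h ‖ x ‖))
  coordinateSum h i j = begin
    cubeSum (λ x → gate (is+ (lookup x i)) (h ‖ x ‖)) ≡⟨ cubeSum-cong (λ x → cong (λ b → gate b (h ‖ x ‖)) (unanimous-⁅⁆ x i)) ⟨
    supersetSum ⁅ i ⁆ h                               ≡⟨ supersetSum-card ⁅ i ⁆ ⁅ j ⁆ h (trans (∣⁅x⁆∣≡1 i) (sym (∣⁅x⁆∣≡1 j))) ⟩
    supersetSum ⁅ j ⁆ h                               ≡⟨ cubeSum-cong (λ x → cong (λ b → gate b (h ‖ x ‖)) (unanimous-⁅⁆ x j)) ⟩
    cubeSum (λ x → gate (is+ (lookup x j)) (h ‖ x ‖)) ∎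
    where open ≡-Reasoning

  negative+positive : (Φ : VotingRule n) (h : ℕ → ℚ) (i : Fin n) →
    negativeSum Φ h i ℚ.+ positiveSum Φ h i ≡ cubeSum (λ x → gate (is+ (Φ x)) (h ‖ x ‖))
  negative+positive Φ h i = trans (sym (cubeSum-+ (negativeTerm Φ h i) (positiveTerm Φ h i)))
    (cubeSum-cong λ x → cases (lookup x i) (gate (is+ (Φ x)) (h ‖ x ‖)))
    where
    cases : ∀ a q → gate (is+ (opposite a)) q ℚ.+ gate (is+ a) q ≡ q
    cases + q = ℚ.+-identityˡ q
    cases - q = ℚ.+-identityʳ q

  negativeSum-invariant : (Φ : VotingRule n) (h : ℕ → ℚ) (i j : Fin n) →
    positiveSum Φ h i ≡ positiveSum Φ h j → negativeSum Φ h i ≡ negativeSum Φ h j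
  negativeSum-invariant Φ h i j eq = +-cancelʳ (positiveSum Φ h i) (begin
    negativeSum Φ h i ℚ.+ positiveSum Φ h i ≡⟨ negative+positive Φ h i ⟩
    cubeSum (λ x → gate (is+ (Φ x)) (h ‖ x ‖)) ≡⟨ negative+positive Φ h j ⟨
    negativeSum Φ h j ℚ.+ positiveSum Φ h j ≡⟨ cong (negativeSum Φ h j ℚ.+_) eq ⟨
    negativeSum Φ h j ℚ.+ positiveSum Φ h i ∎)
    where open ≡-Reasoning

  positiveSum-+ : (Φ : VotingRule n) (g h : ℕ → ℚ) (i : Fin n) →
    positiveSum Φ (λ k → g k ℚ.+ h k) i ≡ positiveSum Φ g i ℚ.+ positiveSum Φ h i
  positiveSum-+ Φ g h i = trans
    (cubeSum-cong λ x → trans (cong (gate (is+ (lookup x i))) (gate-+ (is+ (Φ x)) (g ‖ x ‖) (h ‖ x ‖)))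
                              (gate-+ (is+ (lookup x i)) (gate (is+ (Φ x)) (g ‖ x ‖)) (gate (is+ (Φ x)) (h ‖ x ‖))))
    (cubeSum-+ (positiveTerm Φ g i) (positiveTerm Φ h i))

  positiveSum-cong : (Φ : VotingRule n) {g h : ℕ → ℚ} → g ≗ h → (i : Fin n) → positiveSum Φ g i ≡ positiveSum Φ h i
  positiveSum-cong Φ g≗h i = cubeSum-cong λ x →
    cong (λ q → gate (is+ (lookup x i)) (gate (is+ (Φ x)) q)) (g≗h ‖ x ‖)

  ⊕-raises : (x : Vec Sign n) (i : Fin n) → lookup x i ≡ - → ‖ x ⊕ i ‖ ≡ suc ‖ x ‖
  ⊕-raises (- ∷ x) zero    refl = refl
  ⊕-raises (- ∷ x) (suc i) eq   = ⊕-raises x i eq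
  ⊕-raises (+ ∷ x) (suc i) eq   = cong suc (⊕-raises x i eq)

  ⊕-lowers : (x : Vec Sign n) (i : Fin n) → lookup x i ≡ + → ‖ x ‖ ≡ suc ‖ x ⊕ i ‖
  ⊕-lowers (+ ∷ x) zero    refl = refl
  ⊕-lowers (- ∷ x) (suc i) eq   = ⊕-lowers x i eq
  ⊕-lowers (+ ∷ x) (suc i) eq   = cong suc (⊕-lowers x i eq)

  lookup-⊕ : (x : Vec Sign n) (i : Fin n) → lookup (x ⊕ i) i ≡ opposite (lookup x i)
  lookup-⊕ x i = lookup∘updateAt i x

  ≤ˢ-refl : ∀ s → s ≤ˢ s
  ≤ˢ-refl + = s≤ˢ+ +
  ≤ˢ-refl - = -≤ˢs -

  ⊕-≤ : (x : Vec Sign n) (i : Fin n) → lookup x i ≡ + → ∀ j → lookup (x ⊕ i) j ≤ˢ lookup x j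
  ⊕-≤ x i eq j with j ≟ᶠ i
  ... | yes refl = subst (lookup (x ⊕ i) i ≤ˢ_) (sym eq) (s≤ˢ+ (lookup (x ⊕ i) i))
  ... | no j≢i   = subst (_≤ˢ lookup x j) (sym (lookup∘updateAt′ j i j≢i x)) (≤ˢ-refl (lookup x j))

  ≤-⊕ : (x : Vec Sign n) (i : Fin n) → lookup x i ≡ - → ∀ j → lookup x j ≤ˢ lookup (x ⊕ i) j
  ≤-⊕ x i eq j with j ≟ᶠ i
  ... | yes refl = subst (_≤ˢ lookup (x ⊕ i) i) (sym eq) (-≤ˢs (lookup (x ⊕ i) i))
  ... | no j≢i   = subst (lookup x j ≤ˢ_) (sym (lookup∘updateAt′ j i j≢i x)) (≤ˢ-refl (lookup x j))

  -- By monotonicity [i pivotal at x] = x_i ([Φ x = +] − [Φ (x ⊕ i) = +]); the identity sums this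
  -- over the cube, with terms moved so that no subtraction occurs.
  pivotal-balance : {Φ : VotingRule n} → IsMonotone Φ → (h : ℕ → ℚ) (i : Fin n) →
    pivotalSum Φ h i ℚ.+ (negativeSum Φ h i ℚ.+ negativeSum Φ (h ∘ suc) i) ≡
    positiveSum Φ h i ℚ.+ positiveSum Φ (h ∘ pred) i
  pivotal-balance {n} {Φ} mono h i = begin
    pivotalSum Φ h i ℚ.+ (negativeSum Φ h i ℚ.+ negativeSum Φ (h ∘ suc) i)
      -- Reindexing by `x ↦ x ⊕ i` sends vectors with `-` at i to vectors with `+` at i, one level
      -- higher; the shift by `suc` makes the weight refer to the new level.
      ≡⟨ cong (λ q → pivotalSum Φ h i ℚ.+ (negativeSum Φ h i ℚ.+ q))
           (trans (sym (cubeSum-⊕ i (negativeTerm Φ (h ∘ suc) i))) (cubeSum-cong flip-down)) ⟩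
    pivotalSum Φ h i ℚ.+ (negativeSum Φ h i ℚ.+ cubeSum down)
      ≡⟨ trans (cubeSum-+ (pivotalTerm Φ h i) (λ x → negativeTerm Φ h i x ℚ.+ down x))
           (cong (pivotalSum Φ h i ℚ.+_) (cubeSum-+ (negativeTerm Φ h i) down)) ⟨
    cubeSum (λ x → pivotalTerm Φ h i x ℚ.+ (negativeTerm Φ h i x ℚ.+ down x))
      ≡⟨ cubeSum-cong pointwise ⟩
    cubeSum (λ x → positiveTerm Φ h i x ℚ.+ up x)
      ≡⟨ cubeSum-+ (positiveTerm Φ h i) up ⟩
    positiveSum Φ h i ℚ.+ cubeSum up
      ≡⟨ cong (positiveSum Φ h i ℚ.+_)
           (trans (sym (cubeSum-⊕ i (positiveTerm Φ (h ∘ pred) i))) (cubeSum-cong flip-up)) ⟨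
    positiveSum Φ h i ℚ.+ positiveSum Φ (h ∘ pred) i ∎
    where
    open ≡-Reasoning
    down up : Vec Sign n → ℚ
    down x = gate (is+ (lookup x i)) (gate (is+ (Φ (x ⊕ i))) (h ‖ x ‖))
    up x   = gate (is+ (opposite (lookup x i))) (gate (is+ (Φ (x ⊕ i))) (h ‖ x ‖))

    flip-down : ∀ x → gate (is+ (opposite (lookup (x ⊕ i) i))) (gate (is+ (Φ (x ⊕ i))) (h (suc ‖ x ⊕ i ‖))) ≡ down x
    flip-down x rewrite lookup-⊕ x i with lookup x i in eq
    ... | + = cong (gate (is+ (Φ (x ⊕ i))) ∘ h) (sym (⊕-lowers x i eq))
    ... | - = refl

    -- `pred` is exact here: only vectors with a plus at i contribute, and their level is not 0.
    flip-up : ∀ x → gate (is+ (lookup (x ⊕ i) i)) (gate (is+ (Φ (x ⊕ i))) (h (pred ‖ x ⊕ i ‖))) ≡ up x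
    flip-up x rewrite lookup-⊕ x i with lookup x i in eq
    ... | + = refl
    ... | - = cong (gate (is+ (Φ (x ⊕ i))) ∘ h) (cong pred (⊕-raises x i eq))

    cases : ∀ a F F′ q → (a ≡ + → F′ ≤ˢ F) → (a ≡ - → F ≤ˢ F′) →
      gate (not (does (F ≟ˢ F′))) q ℚ.+ (gate (is+ (opposite a)) (gate (is+ F) q) ℚ.+ gate (is+ a) (gate (is+ F′) q)) ≡
      gate (is+ a) (gate (is+ F) q) ℚ.+ gate (is+ (opposite a)) (gate (is+ F′) q)
    cases + + + q _ _ = trans (ℚ.+-identityˡ _) (ℚ.+-comm 0ℚ q)
    cases + + - q _ _ = refl
    -- The two contradictory patterns are those in which the flip at i would move `Φ` against the
    -- direction of the flip.
    cases + - + q le _ = contradiction (≤ˢ-- {+} (le refl)) λ ()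
    cases + - - q _ _ = refl
    cases - + + q _ _ = trans (ℚ.+-identityˡ _) (ℚ.+-comm q 0ℚ)
    cases - + - q _ le = contradiction (≤ˢ-- {+} (le refl)) λ ()
    cases - - + q _ _ = ℚ.+-comm q 0ℚ
    cases - - - q _ _ = refl

    pointwise : ∀ x → pivotalTerm Φ h i x ℚ.+ (negativeTerm Φ h i x ℚ.+ down x) ≡ positiveTerm Φ h i x ℚ.+ up x
    pointwise x = cases (lookup x i) (Φ x) (Φ (x ⊕ i)) (h ‖ x ‖)
      (λ eq → mono x (x ⊕ i) (⊕-≤ x i eq)) (λ eq → mono (x ⊕ i) x (≤-⊕ x i eq))

  pivotalSum-invariant : {Φ : VotingRule n} → IsMonotone Φ → (∀ h i j → positiveSum Φ h i ≡ positiveSum Φ h j) →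
    ∀ h i j → pivotalSum Φ h i ≡ pivotalSum Φ h j
  pivotalSum-invariant {Φ = Φ} mono inv h i j = +-cancelʳ (negativeSum Φ h i ℚ.+ negativeSum Φ (h ∘ suc) i) (begin
    pivotalSum Φ h i ℚ.+ (negativeSum Φ h i ℚ.+ negativeSum Φ (h ∘ suc) i) ≡⟨ pivotal-balance {Φ = Φ} mono h i ⟩
    positiveSum Φ h i ℚ.+ positiveSum Φ (h ∘ pred) i ≡⟨ cong₂ ℚ._+_ (inv h i j) (inv (h ∘ pred) i j) ⟩
    positiveSum Φ h j ℚ.+ positiveSum Φ (h ∘ pred) j ≡⟨ pivotal-balance {Φ = Φ} mono h j ⟨
    pivotalSum Φ h j ℚ.+ (negativeSum Φ h j ℚ.+ negativeSum Φ (h ∘ suc) j)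
      ≡⟨ cong (pivotalSum Φ h j ℚ.+_) (cong₂ ℚ._+_ (neg h) (neg (h ∘ suc))) ⟩
    pivotalSum Φ h j ℚ.+ (negativeSum Φ h i ℚ.+ negativeSum Φ (h ∘ suc) i) ∎)
    where
    open ≡-Reasoning
    neg : ∀ h → negativeSum Φ h j ≡ negativeSum Φ h i
    neg h = negativeSum-invariant Φ h j i (inv h j i)

  -- The approximants of p - and p + need not sum to 1, but the influences agree as homogeneous
  -- polynomials in them.
  binomialWeight : ℕ → ℚ → ℚ → ℕ → ℚ
  binomialWeight n a b m = (m ⋆ b) ℚ.* ((n ∸ m) ⋆ a)

  approx-⊗ : ∀ p (x : Vec Sign n) k →
    approx ((p ^⊗) x) k ≡ binomialWeight n (approx (mass p -) k) (approx (mass p +) k) ‖ x ‖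
  approx-⊗ p []      k = refl
  approx-⊗ {suc n} p (- ∷ x) k = begin
    a ℚ.* approx ((p ^⊗) x) k                    ≡⟨ cong (a ℚ.*_) (approx-⊗ p x k) ⟩
    a ℚ.* ((‖ x ‖ ⋆ b) ℚ.* ((n ∸ ‖ x ‖) ⋆ a))
      ≡⟨ solve 3 (λ a b c → a :* (b :* c) := b :* (a :* c)) refl a (‖ x ‖ ⋆ b) ((n ∸ ‖ x ‖) ⋆ a) ⟩
    (‖ x ‖ ⋆ b) ℚ.* (suc (n ∸ ‖ x ‖) ⋆ a)
      ≡⟨ cong (λ m → (‖ x ‖ ⋆ b) ℚ.* (m ⋆ a)) (ℕ.+-∸-assoc 1 (count≤n (+ ≟ˢ_) x)) ⟨
    (‖ x ‖ ⋆ b) ℚ.* ((suc n ∸ ‖ x ‖) ⋆ a)         ∎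
    where
    open ≡-Reasoning
    open +-*-Solver
    a = approx (mass p -) k
    b = approx (mass p +) k
  approx-⊗ p (+ ∷ x) k = trans (cong (approx (mass p +) k ℚ.*_) (approx-⊗ p x k))
    (sym (ℚ.*-assoc (approx (mass p +) k) _ _))

  approx-influence : ∀ p i (Φ : VotingRule n) k → approx (influence (p ^⊗) i Φ) k ≡
    pivotalSum Φ (binomialWeight n (approx (mass p -) k) (approx (mass p +) k)) i
  approx-influence p i Φ k = trans
    (approx-sumCube (λ x → if not (does (Φ x ≟ˢ Φ (x ⊕ i))) then (p ^⊗) x else 0ᴿ) k)
    (cubeSum-cong λ x → trans (approx-if (not (does (Φ x ≟ˢ Φ (x ⊕ i)))) ((p ^⊗) x))
      (cong (gate (not (does (Φ x ≟ˢ Φ (x ⊕ i))))) (approx-⊗ p x k)))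
    where
    approx-if : ∀ b r → approx (if b then r else 0ᴿ) k ≡ gate b (approx r k)
    approx-if true  r = refl
    approx-if false r = refl

  ≡⇒≃ᴿ : ∀ {x y} → (∀ k → approx x k ≡ approx y k) → x ≃ᴿ y
  ≡⇒≃ᴿ {x} {y} eq δ 0<δ = 0 , λ k _ → subst (λ r → ℚ.∣ r ∣ ℚ.≤ δ)
    (sym (trans (cong (ℚ._- approx y k) (eq k)) (ℚ.+-inverseʳ (approx y k)))) (ℚ.<⇒≤ 0<δ)

  unbiased : {Φ : VotingRule n} → IsMonotone Φ → (∀ h i j → positiveSum Φ h i ≡ positiveSum Φ h j) → IsUnbiased Φ
  unbiased {n} {Φ} mono inv p i j = ≡⇒≃ᴿ {influence (p ^⊗) i Φ} {influence (p ^⊗) j Φ} λ k →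
    trans (approx-influence p i Φ k) (trans (pivotalSum-invariant {Φ = Φ} mono inv
           (binomialWeight n (approx (mass p -) k) (approx (mass p +) k)) i j) (sym (approx-influence p j Φ k)))

  -- Independence of the coordinate for coalition rules

  ‖opposite‖ : (x : Vec Sign n) → ‖ map opposite x ‖ ≡ n ∸ ‖ x ‖
  ‖opposite‖ x = trans (sym (ℕ.m+n∸n≡m ‖ map opposite x ‖ ‖ x ‖)) (cong (_∸ ‖ x ‖) (‖‖-complement x))

  reflect-minority : n % 2 ≡ 1 → ∀ k → n ℕ.≤ k ℕ.+ k → (n ∸ k) ℕ.+ (n ∸ k) ℕ.< n
  reflect-minority {n} odd k n≤2k with ℕ.≤-total k n
  -- Weights live on all of ℕ, so k may exceed n; then `n ∸ k` is 0 and oddness supplies 0 < n.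
  ... | inj₂ n≤k rewrite ℕ.m≤n⇒m∸n≡0 n≤k = ℕ.n≢0⇒n>0 (odd≢m+m odd 0 ∘ sym)
  ... | inj₁ k≤n = subst (n ∸ k ℕ.+ (n ∸ k) ℕ.<_) (ℕ.m∸n+n≡m k≤n) (ℕ.+-monoʳ-< (n ∸ k) n∸k<k)
    where
    n<2k : n ℕ.< k ℕ.+ k
    n<2k = ℕ.≤∧≢⇒< n≤2k (odd≢m+m odd k ∘ sym)
    n∸k<k : n ∸ k ℕ.< k
    n∸k<k = ℕ.+-cancelʳ-< k (n ∸ k) k (subst (ℕ._< k ℕ.+ k) (sym (ℕ.m∸n+n≡m k≤n)) n<2k)

  module Influence {n} (β : Fin n → Subset n) {s}
    (odd : n % 2 ≡ 1)
    (meet : ∀ u v → ∃[ i ] (i ∈ β u × i ∈ β v))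
    (∣β∣ : ∀ v → ∣ β v ∣ ≡ s)
    (β-sym : ∀ {u v} → u ∈ β v → v ∈ β u)
    (large : ∀ {u v} → u ≢ v → n ℕ.≤ ∣ β u ∪ β v ∣ ℕ.+ ∣ β u ∪ β v ∣)
    where

    open CoalitionRule β
    open Intersecting meet

    -- Two coalitions among the pluses put their union there. As `Minority` is strict, a union of at
    -- least n/2 elements is already too large.
    unanimous-unique : ∀ x → Minority x → ∀ {u v} → Unanimous + x (β u) → Unanimous + x (β v) → u ≡ v
    unanimous-unique x lo {u} {v} bu bv = decidable-stable (u ≟ᶠ v) λ u≢v →
      let le = ∣unanimous∣≤‖‖ x (unanimous-∪ {x = x} bu bv) in
      ℕ.<-irrefl refl (ℕ.≤-<-trans (ℕ.≤-trans (large u≢v) (ℕ.+-mono-≤ le le)) lo)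

    -- Uniqueness leaves at most one nonzero summand, so the existence of a covered coalition
    -- becomes a sum, which can be exchanged with the sum over the cube.
    minority-expansion : ∀ x → Minority x → ∀ q →
      gate (is+ (Φ x)) q ≡ sum (λ v → gate (does (unanimous? + (β v) x)) q)
    minority-expansion x lo q = expand (hasUnanimous? + x)
      where
      open ≡-Reasoning
      term : Fin n → ℚ
      term v = gate (does (unanimous? + (β v) x)) q
      term≡0 : ∀ {v} → ¬ Unanimous + x (β v) → term v ≡ 0ℚ
      term≡0 {v} ¬u = cong (λ b → gate b q) (dec-false (unanimous? + (β v) x) ¬u)
      Φ-negative : ¬ HasUnanimous + x → ∀ t → Φ x ≡ t → is+ t ≡ false
      Φ-negative none - _  = refl
      Φ-negative none + eq = contradiction (minority-unanimous x lo eq) none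
      expand : Dec (HasUnanimous + x) → gate (is+ (Φ x)) q ≡ sum term
      expand (yes (v , u)) = begin
        gate (is+ (Φ x)) q ≡⟨ cong (λ t → gate (is+ t) q) (Φ-unanimous + x (v , u)) ⟩
        q                  ≡⟨ cong (λ b → gate b q) (dec-true (unanimous? + (β v) x) u) ⟨
        term v             ≡⟨ sum-single term v (λ w w≢v → term≡0 λ u′ → w≢v (unanimous-unique x lo u′ u)) ⟨
        sum term           ∎
      expand (no none) = begin
        gate (is+ (Φ x)) q ≡⟨ cong (λ b → gate b q) (Φ-negative none (Φ x) refl) ⟩
        0ℚ                 ≡⟨ sum-zero term (λ v → term≡0 λ u → none (v , u)) ⟨
        sum term           ∎

    gate-unanimous : ∀ x i v q → gate (is+ (lookup x i)) (gate (does (unanimous? + (β v) x)) q) ≡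
                     gate (does (unanimous? + (β v ∪ ⁅ i ⁆) x)) q
    gate-unanimous x i v q with lookup x i in eq
    ... | - = cong (λ b → gate b q) (sym (dec-false (unanimous? + (β v ∪ ⁅ i ⁆) x)
                λ u → contradiction (trans (sym eq) (u i (x∈p∪q⁺ (inj₂ (x∈⁅x⁆ i))))) λ ()))
    ... | + = cong (λ b → gate b q) (does-⇔
                (mk⇔ (λ u → unanimous-∪ {x = x} u λ j j∈ → trans (cong (lookup x) (x∈⁅y⁆⇒x≡y i j∈)) eq)
                     (λ u j j∈ → u j (x∈p∪q⁺ (inj₁ j∈))))
                (unanimous? + (β v) x) (unanimous? + (β v ∪ ⁅ i ⁆) x))

    gate-sum : ∀ b (f : Fin n → ℚ) → gate b (sum f) ≡ sum (λ v → gate b (f v))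
    gate-sum true  f = refl
    gate-sum false f = sym (sum-zero {n} (λ _ → 0ℚ) λ _ → refl)

    -- The expansion into coalitions is justified below n/2. Above it the weight vanishes and both
    -- sides are 0, so the later sum over supersets may run through the whole cube.
    minority-positiveTerm : ∀ {h} → (∀ k → n ℕ.≤ k ℕ.+ k → h k ≡ 0ℚ) → ∀ i x →
      positiveTerm Φ h i x ≡ sum (λ v → gate (does (unanimous? + (β v ∪ ⁅ i ⁆) x)) (h ‖ x ‖))
    minority-positiveTerm {h} h≡0 i x with minority-or-majority odd x
    ... | inj₁ lo = begin
      gate (is+ (lookup x i)) (gate (is+ (Φ x)) (h ‖ x ‖))
        ≡⟨ cong (gate (is+ (lookup x i))) (minority-expansion x lo (h ‖ x ‖)) ⟩
      gate (is+ (lookup x i)) (sum λ v → gate (does (unanimous? + (β v) x)) (h ‖ x ‖))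
        ≡⟨ gate-sum (is+ (lookup x i)) (λ v → gate (does (unanimous? + (β v) x)) (h ‖ x ‖)) ⟩
      sum (λ v → gate (is+ (lookup x i)) (gate (does (unanimous? + (β v) x)) (h ‖ x ‖)))
        ≡⟨ sum-cong-≗ (λ v → gate-unanimous x i v (h ‖ x ‖)) ⟩
      sum (λ v → gate (does (unanimous? + (β v ∪ ⁅ i ⁆) x)) (h ‖ x ‖)) ∎
      where open ≡-Reasoning
    ... | inj₂ hi rewrite h≡0 ‖ x ‖ (ℕ.<⇒≤ hi) = begin
      gate (is+ (lookup x i)) (gate (is+ (Φ x)) 0ℚ) ≡⟨ cong (gate (is+ (lookup x i))) (gate-0 (is+ (Φ x))) ⟩
      gate (is+ (lookup x i)) 0ℚ                    ≡⟨ gate-0 (is+ (lookup x i)) ⟩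
      0ℚ ≡⟨ sum-zero (λ v → gate (does (unanimous? + (β v ∪ ⁅ i ⁆) x)) 0ℚ)
              (λ v → gate-0 (does (unanimous? + (β v ∪ ⁅ i ⁆) x))) ⟨
      sum (λ v → gate (does (unanimous? + (β v ∪ ⁅ i ⁆) x)) 0ℚ) ∎
      where open ≡-Reasoning

    -- By symmetry the coalitions containing i are those indexed by the elements of `β i`, so their
    -- number is the common size `s`: a bound on sizes of coalitions becomes a count of coalitions
    -- through a voter.
    lookup-sym : ∀ u v → lookup (β v) u ≡ lookup (β u) v
    lookup-sym u v with lookup (β v) u in eq | lookup (β u) v in eq′
    ... | true  | true  = refl
    ... | false | false = refl
    ... | true  | false = trans (sym ([]=⇒lookup (β-sym (lookup⇒[]= u (β v) eq)))) eq′
    ... | false | true  = trans (sym eq) ([]=⇒lookup (β-sym (lookup⇒[]= v (β u) eq′)))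

    ∣β∪⁅i⁆∣ : ∀ i v → ∣ β v ∪ ⁅ i ⁆ ∣ ≡ (if lookup (β i) v then s else suc s)
    ∣β∪⁅i⁆∣ i v = begin
      ∣ β v ∪ ⁅ i ⁆ ∣                                      ≡⟨ ∣p∪⁅i⁆∣ (β v) i ⟩
      (if lookup (β v) i then ∣ β v ∣ else suc ∣ β v ∣)    ≡⟨ cong₂ (λ b k → if b then k else suc k) (lookup-sym i v) (∣β∣ v) ⟩
      (if lookup (β i) v then s else suc s)                ∎
      where open ≡-Reasoning

    positiveSum-minority : ∀ {h} → (∀ k → n ℕ.≤ k ℕ.+ k → h k ≡ 0ℚ) → ∀ i j → positiveSum Φ h i ≡ positiveSum Φ h j
    positiveSum-minority {h} h≡0 i j = begin
      positiveSum Φ h i                          ≡⟨ reduce i ⟩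
      (s · f true) ℚ.+ ((n ∸ s) · f false)       ≡⟨ reduce j ⟨
      positiveSum Φ h j                          ∎
      where
      open ≡-Reasoning
      f : Bool → ℚ
      f b = cubeSum {n ∸ (if b then s else suc s)} λ y → h ((if b then s else suc s) ℕ.+ ‖ y ‖)
      reduce : ∀ i → positiveSum Φ h i ≡ (s · f true) ℚ.+ ((n ∸ s) · f false)
      reduce i = begin
        positiveSum Φ h i
          ≡⟨ cubeSum-cong (minority-positiveTerm {h} h≡0 i) ⟩
        cubeSum (λ x → sum (λ v → gate (does (unanimous? + (β v ∪ ⁅ i ⁆) x)) (h ‖ x ‖)))
          ≡⟨ cubeSum-∑ (λ x v → gate (does (unanimous? + (β v ∪ ⁅ i ⁆) x)) (h ‖ x ‖)) ⟩
        sum (λ v → supersetSum (β v ∪ ⁅ i ⁆) h)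
          ≡⟨ sum-cong-≗ (λ v → trans (supersetSum-reduce (β v ∪ ⁅ i ⁆) h)
               (cong (λ k → cubeSum {n ∸ k} λ y → h (k ℕ.+ ‖ y ‖)) (∣β∪⁅i⁆∣ i v))) ⟩
        sum (λ v → f (lookup (β i) v))
          ≡⟨ ∑-bool (β i) f ⟩
        (∣ β i ∣ · f true) ℚ.+ (∣ ∁ (β i) ∣ · f false)
          ≡⟨ cong₂ (λ k l → (k · f true) ℚ.+ (l · f false)) (∣β∣ i) (trans (∣∁p∣≡n∸∣p∣ (β i)) (cong (n ∸_) (∣β∣ i))) ⟩
        (s · f true) ℚ.+ ((n ∸ s) · f false) ∎

    -- Reflection x ↦ −x turns x_i = + = Φ x into x_i = − = Φ x, which inclusion–exclusion
    -- reduces to the case of fewer than n/2 pluses.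
    positiveSum-majority : ∀ {h} → (∀ k → k ℕ.+ k ℕ.< n → h k ≡ 0ℚ) → ∀ i j → positiveSum Φ h i ≡ positiveSum Φ h j
    positiveSum-majority {h} h≡0 i j = begin
      positiveSum Φ h i     ≡⟨ reflected i ⟩
      cubeSum (reflectedTerm i) ≡⟨ +-cancelʳ c (trans (balance i)
        (trans (cong (whole ℚ.+_) (positiveSum-minority {h′} h′≡0 i j))
        (trans (sym (balance j))
               -- `c` is formed with `i`, so the coordinate term of `j` is exchanged for that of `i`
               -- before cancelling.
               (cong (λ q → cubeSum (reflectedTerm j) ℚ.+ (q ℚ.+ positive)) (coordinateSum h′ j i))))) ⟩
      cubeSum (reflectedTerm j) ≡⟨ reflected j ⟨
      positiveSum Φ h j     ∎
      where
      open ≡-Reasoning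
      h′ : ℕ → ℚ
      h′ k = h (n ∸ k)
      h′≡0 : ∀ k → n ℕ.≤ k ℕ.+ k → h′ k ≡ 0ℚ
      h′≡0 k n≤2k = h≡0 (n ∸ k) (reflect-minority odd k n≤2k)

      reflectedTerm coordinateTerm : Fin n → Vec Sign n → ℚ
      reflectedTerm i x = gate (is+ (opposite (lookup x i))) (gate (is+ (opposite (Φ x))) (h′ ‖ x ‖))
      coordinateTerm i x = gate (is+ (lookup x i)) (h′ ‖ x ‖)
      positive whole c : ℚ
      positive = cubeSum λ x → gate (is+ (Φ x)) (h′ ‖ x ‖)
      whole = cubeSum {n} λ x → h′ ‖ x ‖
      c = cubeSum (coordinateTerm i) ℚ.+ positive

      reflected : ∀ i → positiveSum Φ h i ≡ cubeSum (reflectedTerm i)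
      reflected i = trans (sym (cubeSum-opposite (positiveTerm Φ h i))) (cubeSum-cong λ x →
        trans (cong₂ (λ a b → gate (is+ a) (gate (is+ b) (h ‖ map opposite x ‖)))
                     (lookup-map i opposite x) (Φ-odd odd x))
              (cong (gate (is+ (opposite (lookup x i))) ∘ gate (is+ (opposite (Φ x))) ∘ h) (‖opposite‖ x)))

      cases : ∀ a b q → gate (is+ (opposite a)) (gate (is+ (opposite b)) q) ℚ.+ (gate (is+ a) q ℚ.+ gate (is+ b) q) ≡
                        q ℚ.+ gate (is+ a) (gate (is+ b) q)
      cases + + q = ℚ.+-identityˡ (q ℚ.+ q)
      cases + - q = ℚ.+-identityˡ (q ℚ.+ 0ℚ)
      cases - + q = trans (ℚ.+-identityˡ (0ℚ ℚ.+ q)) (ℚ.+-comm 0ℚ q)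
      cases - - q = refl

      balance : ∀ i → cubeSum (reflectedTerm i) ℚ.+ (cubeSum (coordinateTerm i) ℚ.+ positive) ≡ whole ℚ.+ positiveSum Φ h′ i
      balance i = begin
        cubeSum (reflectedTerm i) ℚ.+ (cubeSum (coordinateTerm i) ℚ.+ positive)
          ≡⟨ trans (cubeSum-+ (reflectedTerm i) (λ x → coordinateTerm i x ℚ.+ gate (is+ (Φ x)) (h′ ‖ x ‖)))
               (cong (cubeSum (reflectedTerm i) ℚ.+_) (cubeSum-+ (coordinateTerm i) (λ x → gate (is+ (Φ x)) (h′ ‖ x ‖)))) ⟨
        cubeSum (λ x → reflectedTerm i x ℚ.+ (coordinateTerm i x ℚ.+ gate (is+ (Φ x)) (h′ ‖ x ‖)))
          ≡⟨ cubeSum-cong (λ x → cases (lookup x i) (Φ x) (h′ ‖ x ‖)) ⟩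
        cubeSum (λ x → h′ ‖ x ‖ ℚ.+ positiveTerm Φ h′ i x)
          ≡⟨ cubeSum-+ {n} (λ x → h′ ‖ x ‖) (positiveTerm Φ h′ i) ⟩
        whole ℚ.+ positiveSum Φ h′ i ∎

    positiveSum-invariant : ∀ h i j → positiveSum Φ h i ≡ positiveSum Φ h j
    positiveSum-invariant h i j = begin
      positiveSum Φ h i                          ≡⟨ split i ⟩
      positiveSum Φ lo i ℚ.+ positiveSum Φ hi i
        ≡⟨ cong₂ ℚ._+_ (positiveSum-minority {lo} lo≡0 i j) (positiveSum-majority {hi} hi≡0 i j) ⟩
      positiveSum Φ lo j ℚ.+ positiveSum Φ hi j  ≡⟨ split j ⟨
      positiveSum Φ h j                          ∎
      where
      open ≡-Reasoning
      isLow : ℕ → Bool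
      isLow k = does (k ℕ.+ k ℕ.<? n)
      lo hi : ℕ → ℚ
      lo k = gate (isLow k) (h k)
      hi k = gate (not (isLow k)) (h k)
      lo≡0 : ∀ k → n ℕ.≤ k ℕ.+ k → lo k ≡ 0ℚ
      lo≡0 k n≤2k = cong (λ b → gate b (h k)) (dec-false (k ℕ.+ k ℕ.<? n) (ℕ.≤⇒≯ n≤2k))
      hi≡0 : ∀ k → k ℕ.+ k ℕ.< n → hi k ≡ 0ℚ
      hi≡0 k 2k<n = cong (λ b → gate (not b) (h k)) (dec-true (k ℕ.+ k ℕ.<? n) 2k<n)
      lo+hi : ∀ b q → q ≡ gate b q ℚ.+ gate (not b) q
      lo+hi true  q = sym (ℚ.+-identityʳ q)
      lo+hi false q = sym (ℚ.+-identityˡ q)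
      split : ∀ i → positiveSum Φ h i ≡ positiveSum Φ lo i ℚ.+ positiveSum Φ hi i
      split i = trans (positiveSum-cong Φ (λ k → lo+hi (isLow k) (h k)) i) (positiveSum-+ Φ lo hi i)

    Φ-unbiased : IsUnbiased Φ
    Φ-unbiased = unbiased (Φ-mono odd) positiveSum-invariant

  -- Distances and balls of radius 1

  -- Stated for `applyUpTo f` because the tail of `upTo n` is not itself an `upTo`; the induction
  -- replaces `f` by `f ∘ suc`.
  head-filter-≤ : {P : Pred ℕ 0ℓ} (P? : Decidable P) (f : ℕ → ℕ) → (∀ {i j} → i ℕ.≤ j → f i ℕ.≤ f j) →
    ∀ {k n} → k ℕ.< n → P (f k) → head (filter P? (applyUpTo f n)) ≤∞ [ f k ]
  head-filter-≤ P? f mono {k} {suc n} k<n Pk with P? (f 0)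
  ... | yes _ = ≤[ mono z≤n ]
  head-filter-≤ P? f mono {zero}  {suc n} k<n       Pk | no ¬P0 = contradiction Pk ¬P0
  head-filter-≤ P? f mono {suc k} {suc n} (s≤s k<n) Pk | no ¬P0 = head-filter-≤ P? (f ∘ suc) (mono ∘ s≤s) k<n Pk

  head-filter-sound : {P : Pred ℕ 0ℓ} (P? : Decidable P) (xs : List ℕ) → ∀ {k} →
    head (filter P? xs) ≡ [ k ] → P k
  head-filter-sound P? (x ∷ xs) eq with P? x
  head-filter-sound P? (x ∷ xs) refl | yes Px = Px
  ... | no _ = head-filter-sound P? xs eq

  -- `dist` searches only lengths below n, which is the origin of the hypotheses `1 < n` and `2 < n`
  -- further on.
  dist-≤ : (G : Graph n) → ∀ {k u v} → k ℕ.< n → Walk G k u v → dist G u v ≤∞ [ k ]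
  dist-≤ G {k} {u} {v} = head-filter-≤ (λ k → walk? G k u v) id id

  dist-sound : (G : Graph n) → ∀ {k u v} → dist G u v ≡ [ k ] → Walk G k u v
  dist-sound {n} G {k} {u} {v} = head-filter-sound (λ k → walk? G k u v) (upTo n)

  ∈-subset⁺ : {P : Pred (Fin n) 0ℓ} (P? : Decidable P) → ∀ {u} → P u → u ∈ subset P?
  ∈-subset⁺ P? {u} Pu = lookup⇒[]= u _ (trans (lookup∘tabulate _ u) (dec-true (P? u) Pu))

  ∈-subset⁻ : {P : Pred (Fin n) 0ℓ} (P? : Decidable P) → ∀ {u} → u ∈ subset P? → P u
  ∈-subset⁻ P? {u} u∈ with P? u | trans (sym (lookup∘tabulate (λ u → does (P? u)) u)) ([]=⇒lookup u∈)
  ... | yes Pu | _ = Pu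

  ∈-B₁⁺ : (G : Graph n) → 1 ℕ.< n → ∀ {u v} → v ≡ u ⊎ Adj G v u → u ∈ B₁ G v
  ∈-B₁⁺ G 1<n {u} {v} (inj₁ refl) = ∈-subset⁺ (λ u → dist G v u ≤∞? [ 1 ])
    (⁺.≤⁺-trans ℕ.≤-trans (dist-≤ G (ℕ.<-trans (s≤s z≤n) 1<n) []) ≤[ z≤n ])
  ∈-B₁⁺ G 1<n {u} {v} (inj₂ adj) = ∈-subset⁺ (λ u → dist G v u ≤∞? [ 1 ]) (dist-≤ G 1<n (adj ∷ []))

  ∈-B₁⁻ : (G : Graph n) → ∀ {u v} → u ∈ B₁ G v → v ≡ u ⊎ Adj G v u
  ∈-B₁⁻ G {u} {v} u∈ = close (dist G v u) refl (∈-subset⁻ (λ u → dist G v u ≤∞? [ 1 ]) u∈)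
    where
    close : ∀ k → dist G v u ≡ k → k ≤∞ [ 1 ] → v ≡ u ⊎ Adj G v u
    close [ 0 ] eq _ with [] ← dist-sound G {0} eq = inj₁ refl
    close [ 1 ] eq _ with adj ∷ [] ← dist-sound G {1} eq = inj₂ adj
    close [ suc (suc _) ] eq ≤[ s≤s () ]

  B₁-sym : (G : Graph n) → 1 ℕ.< n → ∀ {u v} → u ∈ B₁ G v → v ∈ B₁ G u
  B₁-sym G 1<n u∈v with ∈-B₁⁻ G u∈v
  ... | inj₁ refl = u∈v
  ... | inj₂ adj  = ∈-B₁⁺ G 1<n (inj₂ (symm G adj))

  B₁≡neighbours∪self : (G : Graph n) → 1 ℕ.< n → ∀ v → B₁ G v ≡ subset (adj? G v) ∪ ⁅ v ⁆
  B₁≡neighbours∪self G 1<n v = ⊆-antisym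
    (λ u∈ → x∈p∪q⁺ (split (∈-B₁⁻ G u∈)))
    (λ u∈ → ∈-B₁⁺ G 1<n (unsplit (x∈p∪q⁻ (subset (adj? G v)) ⁅ v ⁆ u∈)))
    where
    split : ∀ {u} → v ≡ u ⊎ Adj G v u → u ∈ subset (adj? G v) ⊎ u ∈ ⁅ v ⁆
    split (inj₁ refl) = inj₂ (x∈⁅x⁆ v)
    split (inj₂ adj)  = inj₁ (∈-subset⁺ (adj? G v) adj)
    unsplit : ∀ {u} → u ∈ subset (adj? G v) ⊎ u ∈ ⁅ v ⁆ → v ≡ u ⊎ Adj G v u
    unsplit (inj₁ u∈) = inj₂ (∈-subset⁻ (adj? G v) u∈)
    unsplit (inj₂ u∈) = inj₁ (sym (x∈⁅y⁆⇒x≡y v u∈))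

  ∣B₁∣ : (G : Graph n) → 1 ℕ.< n → ∀ {d} → IsRegular G d → ∀ v → ∣ B₁ G v ∣ ≡ suc d
  ∣B₁∣ G 1<n reg v
    rewrite B₁≡neighbours∪self G 1<n v | ∣p∪⁅i⁆∣ (subset (adj? G v)) v
    with lookup (subset (adj? G v)) v in eq
  ... | true  = contradiction (∈-subset⁻ (adj? G v) (lookup⇒[]= v _ eq)) (irrefl G refl)
  ... | false = cong suc (reg v)

  dist≤2 : (G : Graph n) → 2 ℕ.< n → (∀ {u v} → u ≢ v → ∃[ w ] (w ∈ B₁ G u × w ∈ B₁ G v)) →
           ∀ u v → dist G u v ≤∞ [ 2 ]
  dist≤2 {n} G 2<n meet u v with u ≟ᶠ v
  ... | yes refl = ⁺.≤⁺-trans ℕ.≤-trans (dist-≤ G (ℕ.<-trans (s≤s z≤n) 2<n) []) ≤[ z≤n ]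
  ... | no u≢v with w , w∈u , w∈v ← meet u≢v = within (∈-B₁⁻ G w∈u) (∈-B₁⁻ G w∈v)
    where
    1<n : 1 ℕ.< n
    1<n = ℕ.<-trans (s≤s (s≤s z≤n)) 2<n
    within : u ≡ w ⊎ Adj G u w → v ≡ w ⊎ Adj G v w → dist G u v ≤∞ [ 2 ]
    within (inj₁ refl) (inj₁ refl) = contradiction refl u≢v
    within (inj₁ refl) (inj₂ vw)   = ⁺.≤⁺-trans ℕ.≤-trans (dist-≤ G 1<n (symm G vw ∷ [])) ≤[ s≤s z≤n ]
    within (inj₂ uw)   (inj₁ refl) = ⁺.≤⁺-trans ℕ.≤-trans (dist-≤ G 1<n (uw ∷ [])) ≤[ s≤s z≤n ]
    within (inj₂ uw)   (inj₂ vw)   = dist-≤ G 2<n (uw ∷ symm G vw ∷ [])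

  -- Halving and rounding up sends both 1 and 2 to 1. Common elements of balls bound the diameter by
  -- 2, and two distinct vertices exclude 0.
  rad≡1 : (G : Graph n) → 2 ℕ.< n → (∀ {u v} → u ≢ v → ∃[ w ] (w ∈ B₁ G u × w ∈ B₁ G v)) →
          rad G ≡ [ 1 ]
  rad≡1 {suc (suc n)} G 2<n meet = radius (diam G) diam≤2 diam≰0
    where
    distances : List ℕ∞
    distances = cartesianProductWith (dist G) (allFin (suc (suc n))) (allFin (suc (suc n)))
    diam≤2 : diam G ≤∞ [ 2 ]
    diam≤2 = max≤v⁺ {xs = distances} ≤[ z≤n ] (cartesianProductWith⁺ (setoid _) (setoid _)
      (dist G) (allFin _) (allFin _) λ {u} {v} _ _ → dist≤2 G 2<n meet u v)
    0-1≤diam : dist G zero (suc zero) ≤∞ diam G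
    0-1≤diam = All.lookup (xs≤max [ 0 ] distances)
      (∈-cartesianProductWith⁺ (dist G) (∈-allFin zero) (∈-allFin (suc zero)))
    distinct : ∀ k → dist G zero (suc zero) ≡ k → ¬ (k ≤∞ [ 0 ])
    distinct [ 0 ] eq ≤[ z≤n ] with () ← dist-sound G {0} {zero} {suc zero} eq
    diam≰0 : ¬ (diam G ≤∞ [ 0 ])
    diam≰0 le = distinct _ refl (⁺.≤⁺-trans ℕ.≤-trans 0-1≤diam le)
    radius : ∀ k → k ≤∞ [ 2 ] → ¬ (k ≤∞ [ 0 ]) → Maybe.map ⌈_/2⌉ k ≡ [ 1 ]
    radius [ 0 ] _ ≰0 = contradiction ≤[ z≤n ] ≰0
    radius [ 1 ] _ _  = refl
    radius [ 2 ] _ _  = refl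
    radius [ suc (suc (suc _)) ] ≤[ s≤s (s≤s ()) ] _
  rad≡1 {1} G (s≤s ()) meet

  ∈-permuteGraph-B₁ : (G : Graph n) → 1 ℕ.< n → (σ : Permutation′ n) → ∀ {u v} →
    u ∈ B₁ (permuteGraph σ G) v ⇔ σ ⟨$⟩ˡ u ∈ B₁ G (σ ⟨$⟩ˡ v)
  ∈-permuteGraph-B₁ G 1<n σ {u} {v} = mk⇔
    (λ u∈ → ∈-B₁⁺ G 1<n (to (∈-B₁⁻ (permuteGraph σ G) u∈)))
    (λ u∈ → ∈-B₁⁺ (permuteGraph σ G) 1<n (from (∈-B₁⁻ G u∈)))
    where
    to : v ≡ u ⊎ Adj G (σ ⟨$⟩ˡ v) (σ ⟨$⟩ˡ u) → σ ⟨$⟩ˡ v ≡ σ ⟨$⟩ˡ u ⊎ Adj G (σ ⟨$⟩ˡ v) (σ ⟨$⟩ˡ u)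
    to (inj₁ eq)  = inj₁ (cong (σ ⟨$⟩ˡ_) eq)
    to (inj₂ adj) = inj₂ adj
    from : σ ⟨$⟩ˡ v ≡ σ ⟨$⟩ˡ u ⊎ Adj G (σ ⟨$⟩ˡ v) (σ ⟨$⟩ˡ u) → v ≡ u ⊎ Adj G (σ ⟨$⟩ˡ v) (σ ⟨$⟩ˡ u)
    from (inj₁ eq)  = inj₁ (trans (sym (inverseʳ σ)) (trans (cong (σ ⟨$⟩ʳ_) eq) (inverseʳ σ)))
    from (inj₂ adj) = inj₂ adj

  module BallAutomorphisms (G : Graph n) {s} (1<n : 1 ℕ.< n)
    (meet : ∀ u v → ∃[ w ] (w ∈ B₁ G u × w ∈ B₁ G v))
    (∣β∣ : ∀ v → ∣ B₁ G v ∣ ≡ s) (2s<n : s ℕ.+ s ℕ.< n) where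

    open CoalitionRule (B₁ G)
    open Automorphisms (B₁ G) meet ∣β∣ 2s<n

    -- The balls of σ(G) are the images under `σ` of the balls of `G`. `image-coalition` produces
    -- preimages, so one inclusion applies it to `flip σ` and the other to `σ`.
    Aut⇒AutB₁ : ∀ σ → Aut Φ σ → AutB₁ G σ
    Aut⇒AutB₁ σ inv =
      (λ { (v , refl) → let w , image = image-coalition {flip σ} (Aut-flip {Φ = Φ} {σ} inv) (σ ⟨$⟩ˡ v) in
        w , ⊆-antisym (λ {u} u∈v → Equivalence.from (image u) (Equivalence.to (∈-permuteGraph-B₁ G 1<n σ) u∈v))
                      (λ {u} u∈w → Equivalence.from (∈-permuteGraph-B₁ G 1<n σ) (Equivalence.to (image u) u∈w)) }) ,
      (λ { (w , refl) → let v , image = image-coalition {σ} inv w in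
        σ ⟨$⟩ʳ v , ⊆-antisym
          (λ {u} u∈w → Equivalence.from (∈-permuteGraph-B₁ G 1<n σ)
            (subst (λ v → σ ⟨$⟩ˡ u ∈ B₁ G v) (sym (inverseˡ σ))
              (Equivalence.from (image (σ ⟨$⟩ˡ u)) (subst (_∈ B₁ G w) (sym (inverseʳ σ)) u∈w))))
          (λ {u} u∈v → subst (_∈ B₁ G w) (inverseʳ σ) (Equivalence.to (image (σ ⟨$⟩ˡ u))
            (subst (λ v → σ ⟨$⟩ˡ u ∈ B₁ G v) (inverseˡ σ)
              (Equivalence.to (∈-permuteGraph-B₁ G 1<n σ) u∈v)))) })

open NaturalEstimates
open RationalEstimates
open Voting
open import Data.Fin.Base using (Fin; fromℕ<)
open import Data.Fin.Permutation using (_≈_) renaming (id to idᵖ)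
open import Data.Fin.Properties using () renaming (_≟_ to _≟ᶠ_)
open import Data.Fin.Subset using (Subset; ∣_∣; _∩_; _∪_; _∈_)
open import Data.Fin.Subset.Properties using (nonempty?; Empty-unique; ∣⊥∣≡0; x∈p∩q⁻)
open import Data.Integer.Base using (+_)
open import Data.Nat.Base using (ℕ; NonZero; _+_; _*_; _∸_; _^_; _≤_; _<_; suc; s≤s; z≤n; _⊔_)
open import Data.Nat.DivMod using (_/_; _%_)
open import Data.Product using (∃!; ∃-syntax; _×_; _,_; proj₁; proj₂; map₂)
open import Data.Sum.Base using (inj₁)
open import Data.Vec.Properties using (tabulate∘lookup)
open import Relation.Nullary.Decidable using (Dec; yes; no)
open import Relation.Nullary.Negation using (contradiction)

private
  variable
    n : ℕ

-- The asymptotic hypotheses and the conclusion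

∣p∣≢0⇒Nonempty : (p : Subset n) → ∣ p ∣ ≢ 0 → ∃[ i ] i ∈ p
∣p∣≢0⇒Nonempty {n} p ∣p∣≢0 with nonempty? p
... | yes p≢∅ = p≢∅
... | no p≡∅  = contradiction (trans (cong ∣_∣ (Empty-unique p≡∅)) (∣⊥∣≡0 n)) ∣p∣≢0

-- Convergence is used at the single tolerance 1/D, so one threshold serves all graphs and all pairs
-- of vertices.
intersection-bounds : ∀ D .{{_ : NonZero D}} (ε : ℕ → ℝ) → ε ⟶0 → 
  ∃[ N ] (∀ n .{{_ : NonZero n}} → N ≤ n → ∀ c d →
  fromℚ ℚ.∣ ι c ℚ.- (+ (d ^ 2)) ℚ./ n ∣ ≤ᴿ ε n *ᴿ fromℚ ((+ (d ^ 2)) ℚ./ n) →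
  c * n * D ≤ d * d * D + (d * d + d * d + n) × d * d * D ≤ c * n * D + (d * d + d * d + n))
intersection-bounds D ε ε⟶0 = proj₁ small , λ n N≤n c d close →
  let bound  = ≤ᴿ-scaled {ε n} 0<δ (0≤/ (d ^ 2) n) close (proj₂ (proj₂ small n N≤n))
      square = cong (d *_) (ℕ.*-identityʳ d)
  in subst (λ s → c * n * D ≤ s * D + (s + s + n)) square (Clearing.upper c (d ^ 2) n D bound) ,
     subst (λ s → s * D ≤ c * n * D + (s + s + n)) square (Clearing.lower c (d ^ 2) n D bound)
  where
  0<δ = ℚ.positive⁻¹ (+ 1 ℚ./ D) {{ℚ.normalize-pos 1 D}}
  small = ε⟶0 (+ 1 ℚ./ D) 0<δ

IsDesiredRule : Graph n → ℕ → VotingRule n → Set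
IsDesiredRule G d Φ = IsOdd Φ × IsMonotone Φ × IsUnbiased Φ × ∃! _≈_ (Aut Φ)
  × (∃[ S ] (IsWinningCoalition Φ S × ∣ S ∣ ≡ d + 1))

-- The estimate on intersections enters only through its two consequences for distinct vertices:
-- their balls meet, and the union has at least n/2 elements.
graphicRule-desired : (n : ℕ) .{{_ : NonZero n}} → 2 < n → n % 2 ≡ 1 →
  (G : Graph n) (d : ℕ) → IsRegular G d → 2 * d + 3 ≤ n → ∃! _≈_ (AutB₁ G) →
  (∀ {u v} → u ≢ v → ∃[ w ] (w ∈ B₁ G u × w ∈ B₁ G v)) →
  (∀ {u v} → u ≢ v → n ≤ ∣ B₁ G u ∪ B₁ G v ∣ + ∣ B₁ G u ∪ B₁ G v ∣) →
  IsDesiredRule G d (graphicRule G)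
graphicRule-desired n 2<n odd G d reg 2d+3≤n (τ , _ , unique) meet large =
  subst (λ r → IsDesiredRule G d (CoalitionRule.Φ (ball G r))) (sym (rad≡1 G 2<n meet))
    ( Φ-odd odd , Φ-mono odd , Φ-unbiased
    -- The identity and `σ` both preserve the set of balls, so both agree with the unique `τ`.
    , (idᵖ , inv-id , λ {σ} inv i →
        trans (sym (unique {idᵖ} (Aut⇒AutB₁ idᵖ inv-id) i)) (unique {σ} (Aut⇒AutB₁ σ inv) i))
    , (B₁ G v₀ , winning v₀ , trans (∣β∣ v₀) (ℕ.+-comm 1 d)) )
  where
  1<n : 1 < n
  1<n = ℕ.<-trans (s≤s (s≤s z≤n)) 2<n
  v₀ : Fin n
  v₀ = fromℕ< 1<n
  meet′ : ∀ u v → ∃[ w ] (w ∈ B₁ G u × w ∈ B₁ G v)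
  meet′ u v = decide (u ≟ᶠ v)
    where
    decide : ∀ {v} → Dec (u ≡ v) → ∃[ w ] (w ∈ B₁ G u × w ∈ B₁ G v)
    decide (yes refl) = u , ∈-B₁⁺ G 1<n (inj₁ refl) , ∈-B₁⁺ G 1<n (inj₁ refl)
    decide (no u≢v)   = meet u≢v
  ∣β∣ = ∣B₁∣ G 1<n reg
  -- This form of the upper bound on d puts the indicator vector of a ball among the minority
  -- vectors.
  2s<n : suc d + suc d < n
  2s<n = ℕ.≤-trans (ℕ.≤-reflexive 2d+3) 2d+3≤n
    where
    2d+3 : suc (suc d + suc d) ≡ 2 * d + 3
    2d+3 = trans (cong (λ k → suc (suc k)) (ℕ.+-suc d d)) (trans (ℕ.+-comm 3 (d + d))
      (cong (λ k → d + k + 3) (sym (ℕ.+-identityʳ d))))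
  open CoalitionRule (B₁ G)
  open Intersecting meet′
  open Influence (B₁ G) odd meet′ ∣β∣ (B₁-sym G 1<n) large
  open BallAutomorphisms G 1<n meet′ ∣β∣ 2s<n
  inv-id : Aut Φ idᵖ
  inv-id x = cong Φ (tabulate∘lookup x)

theorem7 : (ε : ℕ → ℝ) → ε ⟶0 →
    ∃[ N ] ((n : ℕ) .{{_ : NonZero n}} → N ≤ n → n % 2 ≡ 1 →
    (G : Graph n) (d : ℕ) → IsRegular G d →
    293 * n / 1000 ∸ 1 ≤ d → 2 * d + 3 ≤ n →
    ∃! _≈_ (AutB₁ G) →
    ((u v : Fin n) → u ≢ v →
    fromℚ ℚ.∣ (+ ∣ B₁ G u ∩ B₁ G v ∣) ℚ./ 1 ℚ.- (+ (d ^ 2)) ℚ./ n ∣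
    ≤ᴿ ε n *ᴿ fromℚ ((+ (d ^ 2)) ℚ./ n)) →
    IsOdd (graphicRule G)
    × IsMonotone (graphicRule G)
    × IsUnbiased (graphicRule G)
    × ∃! _≈_ (Aut (graphicRule G))
    × (∃[ S ] (IsWinningCoalition (graphicRule G) S × ∣ S ∣ ≡ d + 1)))
theorem7 ε ε⟶0 = proj₁ bounds ⊔ 10000 , λ n N≤n odd G d reg 293n≤ 2d+3≤n rigid near →
  let 10⁴≤n = ℕ.m⊔n≤o⇒n≤o (proj₁ bounds) 10000 N≤n
      2<n    = ℕ.<-≤-trans (ℕ.≤ᵇ⇒≤ 3 10000 _) 10⁴≤n
      1<n    = ℕ.<-trans (s≤s (s≤s z≤n)) 2<n
      low    = degree-bound (293 * n) d 293n≤
      near′  = λ u v u≢v → proj₂ bounds n (ℕ.m⊔n≤o⇒m≤o (proj₁ bounds) 10000 N≤n)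
                             ∣ B₁ G u ∩ B₁ G v ∣ d (near u v u≢v)
  in graphicRule-desired n 2<n odd G d reg 2d+3≤n rigid
    (λ {u} {v} u≢v → map₂ (λ {w} → x∈p∩q⁻ (B₁ G u) (B₁ G v))
      (∣p∣≢0⇒Nonempty (B₁ G u ∩ B₁ G v) (intersection-nonzero
        ∣ B₁ G u ∩ B₁ G v ∣ n d 100000
        (ℕ.<-trans (s≤s z≤n) 1<n) (ℕ.≤ᵇ⇒≤ 7 100000 _) (n≤4d d n low 10⁴≤n) (proj₂ (near′ u v u≢v)))))
    (λ {u} {v} u≢v → union-large n ∣ B₁ G u ∩ B₁ G v ∣ ∣ B₁ G u ∪ B₁ G v ∣ d 100000
        (union-estimate d n low (ℕ.m+n≤o⇒m≤o (2 * d) 2d+3≤n) 10⁴≤n)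
        (proj₁ (near′ u v u≢v))
        (trans (∣p∪q∣+∣p∩q∣ (B₁ G u) (B₁ G v)) (cong₂ _+_ (∣B₁∣ G 1<n reg u) (∣B₁∣ G 1<n reg v))))
  where
  -- With D = 100000 the relative error 2/D in d²/n stays well inside the margin of about 0.00015
  -- left by 0.293.
  bounds = intersection-bounds 100000 ε ε⟶0
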